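{- Let $t\not\equiv 0\pmod 4$ be a fixed positive integer and let $n$ and $k<n$ be positive integers such that $t\mid 2nk$ and such that one of the following holds: (1) $nk$ is odd, $n\geq k\geq 3$, and $\gcd(n,k-1)=1$; (2) $nk$ is odd, $n\geq k$, and $3<k<200$; (3) $nk$ is odd, $n\geq k\geq 3$, and $n\geq (k-2)(k-1)$. Then the number of distinct biembeddings $\Pi$ of $K_{\frac{2nk+t}{t}\times t}$ such that (a) $\mathrm{Aut}(\Pi)=\mathbb{Z}_{2nk+t}$, (b) the faces determined by $\Pi$ have lengths multiples of $k$, is at least $$\left(1-O\left(\tfrac{1}{nk}\right)\right)(nk)!.$$
   Context: Asymptotic convention: $t$ is fixed and the constant implied in $O(\cdot)$ depends only on $t$. Let $v=2nk+t$. $K_{\frac{v}{t}\times t}$ is the complete multipartite graph with $v/t$ parts of size $t$; its vertex set is identified with $\mathbb{Z}_v$, two vertices being adjacent iff their difference is not in the subgroup $J=\frac{v}{t}\mathbb{Z}_v$ of order $t$. A (combinatorial, orientable) embedding of a connected graph $\Gamma$ is a pair $\Pi=(\Gamma,\rho)$ where $\rho$ is a permutation of the oriented edges with $\rho(x,y)=(x,\rho_x(y))$, each $\rho_x$ being a cyclic permutation of all neighbours of $x$; this is equivalent to a cellular embedding into an orientable surface. Two embeddings of the same (labelled) graph are distinct if their rotations $\rho$ are different. Face boundaries are traced by the orbits of $(x,y)\mapsto\rho(y,x)$; the length of a face is the length of the orbit. A biembedding is an embedding whose faces can be coloured with two colours so that each edge lies on one face of each colour. $\mathrm{Aut}(\Pi)$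 is the group of graph automorphisms $\sigma$ (acting on oriented edges by $\sigma(x,y)=(\sigma(x),\sigma(y))$) such that either $\sigma\circ\rho=\rho\circ\sigma$ or $\sigma\circ\rho=\rho^{ -1}\circ\sigma$; $\mathrm{Aut}(\Pi)=\mathbb{Z}_v$ means that it consists exactly of the translations $\tau_g(x)=x+g$, $g\in\mathbb{Z}_v$. -}

module Defs where

open import Data.Bool.Base using (Bool)
open import Data.Fin.Base using (Fin; toℕ)
open import Data.Fin.Permutation using (Permutation′; _⟨$⟩ʳ_)
open import Data.Fin.Properties using (nonZeroIndex; toℕ<n; toℕ-fromℕ<; toℕ-injective)
open import Data.Nat.Base
open import Data.Nat.Divisibility using (_∣_)
open import Data.Nat.DivMod
open import Data.Nat.GeneralisedArithmetic using (iterate)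
open import Data.Nat.Properties
open import Data.Nat.Tactic.RingSolver using (solve-∀)
open import Data.Product.Base using (Σ-syntax; ∃-syntax; _×_; _,_)
open import Data.Sum.Base using (_⊎_)
open import Function.Base using (_∘_)
open import Function.Bundles using (_↔_; module Inverse; _⇔_; module Equivalence)
open import Relation.Binary.Construct.Closure.ReflexiveTransitive using (Star)
open import Relation.Binary.PropositionalEquality
open import Relation.Nullary using (¬_)

private
  variable
    v : ℕ

-- Fin v carries the group structure of ℤ_v; an element of Fin v witnesses that
-- v is nonzero.

_⊕_ : Fin v → Fin v → Fin v
_⊕_ {v} x y = ((toℕ x + toℕ y) mod v) {{nonZeroIndex x}}

_⊖_ : Fin v → Fin v → Fin v
_⊖_ {v} x y = ((toℕ x + (v ∸ toℕ y)) mod v) {{nonZeroIndex x}}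

-- membership in the subgroup dℤ_v

_∈⟨_⟩ : Fin v → ℕ → Set
_∈⟨_⟩ {v} z d = ∃[ i ] z ≡ ((i * d) mod v) {{nonZeroIndex z}}

private
  toℕ-mod : ∀ m v .{{_ : NonZero v}} → toℕ (m mod v) ≡ m % v
  toℕ-mod m v = toℕ-fromℕ< (m%n<n m v)

  mod-cong : ∀ m n v .{{_ : NonZero v}} → m % v ≡ n % v → m mod v ≡ n mod v
  mod-cong m n v eq = toℕ-injective (trans (toℕ-mod m v) (trans eq (sym (toℕ-mod n v))))

  negate-% : ∀ v .{{_ : NonZero v}} p q r → p % v ≡ q % v → p + r ≡ v + v →
             r % v ≡ (pred v * q) % v
  negate-% v@(suc w) p q r p≡q p+r≡2v = begin
    r % v                                ≡⟨ [m+kn]%n≡m%n r q v ⟨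
    (r + q * v) % v                      ≡⟨ cong (_% v) (rearrange r q w) ⟩
    ((q + r) + w * q) % v                ≡⟨ %-distribˡ-+ (q + r) (w * q) v ⟩
    ((q + r) % v + (w * q) % v) % v      ≡⟨ cong (λ z → (z + (w * q) % v) % v) q+r≡0 ⟩
    ((w * q) % v) % v                    ≡⟨ m%n%n≡m%n (w * q) v ⟩
    (w * q) % v                          ∎
    where
    open ≡-Reasoning
    rearrange : ∀ r q w → r + q * suc w ≡ (q + r) + w * q
    rearrange = solve-∀
    q+r≡0 : (q + r) % v ≡ 0
    q+r≡0 = begin
      (q + r) % v          ≡⟨ %-distribˡ-+ q r v ⟩
      (q % v + r % v) % v  ≡⟨ cong (λ z → (z + r % v) % v) p≡q ⟨
      (p % v + r % v) % v  ≡⟨ %-distribˡ-+ p r v ⟨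
      (p + r) % v          ≡⟨ cong (_% v) p+r≡2v ⟩
      (v + v) % v          ≡⟨ [m+n]%n≡m%n v v ⟩
      v % v                ≡⟨ n%n≡0 v ⟩
      0                    ∎

⊖-self-∈ : ∀ d (x : Fin v) → (x ⊖ x) ∈⟨ d ⟩
⊖-self-∈ {v@(suc _)} d x = 0 , mod-cong (toℕ x + (v ∸ toℕ x)) 0 v eq
  where
  eq : (toℕ x + (v ∸ toℕ x)) % v ≡ 0 % v
  eq = trans (cong (_% v) (m+[n∸m]≡n (<⇒≤ (toℕ<n x)))) (trans (n%n≡0 v) (sym (m*n%n≡0 0 v)))

⊖-swap-∈ : ∀ d (x y : Fin v) → (x ⊖ y) ∈⟨ d ⟩ → (y ⊖ x) ∈⟨ d ⟩
⊖-swap-∈ {v@(suc _)} d x y (i , eq) = pred v * i ,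
  mod-cong b (pred v * i * d) v
    (trans (negate-% v a (i * d) b a≡id a+b≡2v) (cong (_% v) (sym (*-assoc (pred v) i d))))
  where
  a b : ℕ
  a = toℕ x + (v ∸ toℕ y)
  b = toℕ y + (v ∸ toℕ x)
  a≡id : a % v ≡ (i * d) % v
  a≡id = trans (sym (toℕ-mod a v)) (trans (cong toℕ eq) (toℕ-mod (i * d) v))
  rearrange : ∀ x y x′ y′ → (x + y′) + (y + x′) ≡ (x + x′) + (y + y′)
  rearrange = solve-∀
  a+b≡2v : a + b ≡ v + v
  a+b≡2v = trans (rearrange (toℕ x) (toℕ y) (v ∸ toℕ x) (v ∸ toℕ y))
             (cong₂ _+_ (m+[n∸m]≡n (<⇒≤ (toℕ<n x))) (m+[n∸m]≡n (<⇒≤ (toℕ<n y))))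

record SimpleGraph (v : ℕ) : Set₁ where
  field
    Adj       : Fin v → Fin v → Set
    symmetric : ∀ {x y} → Adj x y → Adj y x
    loopless  : ∀ {x} → ¬ Adj x x

open SimpleGraph

Connected : SimpleGraph v → Set
Connected Γ = ∀ x y → Star (Adj Γ) x y

-- For t ∣ v this is K_{(v/t)×t}: the parts are the cosets of the subgroup
-- J = (v/t)ℤ_v, which has order t.

completeMultipartite : (v t : ℕ) .{{_ : NonZero t}} → SimpleGraph v
completeMultipartite v t = record
  { Adj       = λ x y → ¬ ((x ⊖ y) ∈⟨ v / t ⟩)
  ; symmetric = λ {x} {y} x∼y y⊖x∈J → x∼y (⊖-swap-∈ (v / t) y x y⊖x∈J)
  ; loopless  = λ {x} x∼x → x∼x (⊖-self-∈ (v / t) x)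
  }

-- Oriented edges (src , tgt).  The adjacency proof is irrelevant, so _≡_ on
-- darts is equality of both endpoints.

record Dart (Γ : SimpleGraph v) : Set where
  constructor dart
  field
    src       : Fin v
    tgt       : Fin v
    .adjacent : Adj Γ src tgt

open Dart public

reverse : {Γ : SimpleGraph v} → Dart Γ → Dart Γ
reverse {Γ = Γ} (dart x y x∼y) = dart y x (symmetric Γ x∼y)

record Embedding (Γ : SimpleGraph v) : Set where
  field
    connected    : Connected Γ
    rotation     : Dart Γ ↔ Dart Γ
    preserve-src : ∀ d → src (Inverse.to rotation d) ≡ src d
    -- the rotation at each vertex x is a single cycle on all neighbours of x
    cyclic       : ∀ d e → src d ≡ src e → ∃[ i ] iterate (Inverse.to rotation) d i ≡ e

  ρ ρ⁻¹ : Dart Γ → Dart Γ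
  ρ   = Inverse.to rotation
  ρ⁻¹ = Inverse.from rotation

  -- the faces are the orbits of (x , y) ↦ ρ (y , x)
  faceStep : Dart Γ → Dart Γ
  faceStep = ρ ∘ reverse

open Embedding public using (ρ; ρ⁻¹; faceStep)

private
  variable
    Γ : SimpleGraph v

SameRotation : Embedding Γ → Embedding Γ → Set
SameRotation Π Π′ = ∀ d → ρ Π d ≡ ρ Π′ d

-- ℓ is the least positive number of face steps returning to d, that is, the
-- length of the orbit of d.

IsFaceLength : Embedding Γ → Dart Γ → ℕ → Set
IsFaceLength Π d ℓ =
  0 < ℓ ×
  iterate (faceStep Π) d ℓ ≡ d ×
  (∀ j → 0 < j → j < ℓ → iterate (faceStep Π) d j ≢ d)

FaceLengthsMultipleOf : ℕ → Embedding Γ → Set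
FaceLengthsMultipleOf k Π = ∀ d → ∃[ ℓ ] IsFaceLength Π d ℓ × k ∣ ℓ

-- A colouring of the faces is a function on darts that is constant on the
-- orbits of faceStep.  The two face sides of the edge {x , y} are at the darts
-- (x , y) and (y , x).

IsBiembedding : Embedding Γ → Set
IsBiembedding {Γ = Γ} Π = Σ[ colour ∈ (Dart Γ → Bool) ]
  (∀ d → colour (faceStep Π d) ≡ colour d) ×
  (∀ d → colour (reverse d) ≢ colour d)

record GraphAutomorphism (Γ : SimpleGraph v) : Set where
  field
    perm      : Permutation′ v
    preserves : ∀ x y → Adj Γ x y ⇔ Adj Γ (perm ⟨$⟩ʳ x) (perm ⟨$⟩ʳ y)

  onVertices : Fin v → Fin v
  onVertices = perm ⟨$⟩ʳ_

  onDarts : Dart Γ → Dart Γ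
  onDarts (dart x y x∼y) =
    dart (onVertices x) (onVertices y) (Equivalence.to (preserves x y) x∼y)

open GraphAutomorphism public using (onVertices; onDarts)

IsAutomorphism : Embedding Γ → GraphAutomorphism Γ → Set
IsAutomorphism Π σ =
  (∀ d → onDarts σ (ρ Π d) ≡ ρ Π (onDarts σ d)) ⊎
  (∀ d → onDarts σ (ρ Π d) ≡ ρ⁻¹ Π (onDarts σ d))

Aut : Embedding Γ → Set
Aut {Γ = Γ} Π = Σ[ σ ∈ GraphAutomorphism Γ ] IsAutomorphism Π σ

AutIsℤᵥ : {Γ : SimpleGraph v} → Embedding Γ → Set
AutIsℤᵥ {v = v} Π =
  (∀ (g : Fin v) → Σ[ (σ , _) ∈ Aut Π ] (∀ x → onVertices σ x ≡ x ⊕ g)) ×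
  (∀ ((σ , _) : Aut Π) → ∃[ g ] ∀ x → onVertices σ x ≡ x ⊕ g)

AtLeast : ℕ → (Embedding Γ → Set) → Set
AtLeast {Γ = Γ} N P = Σ[ Π ∈ (Fin N → Embedding Γ) ]
  (∀ i → P (Π i)) ×
  (∀ i j → SameRotation (Π i) (Π j) → i ≡ j)

{-# OPTIONS --safe #-}

-- Put ρ_x(y) = x + ρ₀(y − x) with ρ₀ a cyclic permutation b₀ → b₁ → … → b_{M−1}
-- of ℤ_v ∖ J, where M = 2nk; the translations are then automorphisms.  Negation
-- acts on the positions by an involution p ↦ p*, and one face step takes
-- (x , b_p) to (x + b_p , b_{p* + 1}).  If p* ≡ p + k mod 2k, with k odd, then
-- all face lengths are multiples of k, and the parity of p is a 2-colouring of
-- the faces.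
--
-- Writing p = 2ka + s, one can choose the involution so that a walk of k face
-- steps returns to its initial position only from the odd p < 2k.  The k pairs
-- {± b_p} with p < 2k are prescribed, with values h, …, 3h where k = 2h + 1,
-- signed so that they close up to a face of length k.  An automorphism must
-- preserve this face pattern at every vertex, which makes it a translation or a
-- reflection; the prescribed values exclude the latter.
--
-- The remaining r = (n − 1)k pairs may be arranged and signed at will, which
-- gives 2^r r! distinct rotations, and this is at least (nk)! since
-- nk ≤ 2^(n−1) once n ≥ 7.  For n ≤ 7 + t the bound is made void by the choice
-- of the constant.

module Submission where

open import Defs
open import Algebra.Bundles using (AbelianGroup)
open import Algebra.Structures using (IsAbelianGroup)
open import Algebra.Consequences.Propositional using (comm∧idˡ⇒id; comm∧invˡ⇒inv)
import Algebra.Properties.AbelianGroup as AbelianGroupProperties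
open import Data.Bool.Base using (Bool; true; false; not; _xor_)
open import Data.Bool.Properties using (not-involutive)
open import Data.Empty using (⊥; ⊥-elim-irr)
open import Data.Fin.Base using (Fin; zero; suc; toℕ; fromℕ<; combine; remQuot; opposite; inject≤; _↑ˡ_; finToFun; punchIn)
open import Data.Fin.Permutation using (Permutation′; permutation; _⟨$⟩ʳ_; _⟨$⟩ˡ_; inverseˡ; inverseʳ; insert; insert-punchIn) renaming (id to idₚ)
open import Data.Fin.Properties using (toℕ<n; toℕ-injective; toℕ-fromℕ<; toℕ-inject≤; toℕ-↑ˡ; ↑ʳ-injective; toℕ-combine; remQuot-combine; combine-remQuot; combine-injectiveˡ; combine-injectiveʳ; opposite-prop; opposite-involutive; pigeonhole; punchIn-injective; +↔⊎; 2↔Bool) renaming (_≟_ to _≟ᶠ_; suc-injective to Fin-suc-injective)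
open import Data.Nat.Base using (ℕ; zero; suc; NonZero; >-nonZero; >-nonZero⁻¹; _+_; _*_; _∸_; _/_; _%_; _^_; _!; _<_; _≤_; _≥_; s≤s; z≤n; z<s; s≤s⁻¹; _≡ᵇ_)
open import Data.Nat.Divisibility using (_∣_; divides; ∣⇒≤; ∣-refl; ∣-trans; ∣m+n∣m⇒∣n; m∣m*n; n∣m*n)
open import Data.Nat.DivMod
open import Data.Nat.GCD using (gcd)
open import Data.Nat.GeneralisedArithmetic using (iterate)
open import Data.Nat.Induction using (<-rec)
open import Data.Nat.Properties
open import Data.Nat.Tactic.RingSolver using (solve-∀)
open import Data.Product.Base using (Σ-syntax; ∃-syntax; _×_; _,_; proj₁; proj₂; map₁; map₂)
open import Data.Product.Properties using (,-injectiveˡ; ,-injectiveʳ)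
open import Data.Sum.Base using (_⊎_; inj₁; inj₂)
open import Function.Base using (_∘_)
open import Function.Bundles using (_↔_; mk↔ₛ′; mk⇔; module Inverse)
open import Function.Construct.Composition using (_↔-∘_)
open import Function.Construct.Symmetry using (↔-sym)
open import Level using (0ℓ)
open import Relation.Binary.Construct.Closure.ReflexiveTransitive using (_◅_) renaming (ε to []⋆)
open import Relation.Binary.PropositionalEquality hiding (J)
open import Relation.Nullary using (¬_; Dec; yes; no; contradiction)
open import Relation.Nullary.Decidable using (map′)
open import Relation.Unary using (Decidable)
open ≡-Reasoning

-- Arithmetic of ℤ_v

-- Translations are automorphisms for free; the difficulty is to exclude all others for every member
-- of a large family. The involution on positions is chosen for this: except at the odd positions
-- below 2k, a walk of k face steps fails to return because its position does not, whatever the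
-- values b_p are. Free choices elsewhere therefore never create a further closed walk of k steps,
-- one argument serves the whole family, and no exceptional members have to be discarded. Two losses
-- threaten the count. A rotation is a cyclic order with no first element, so a priori 2nk listings
-- could share one; position 0 always carries - h, which fixes the start. Prescribing k pairs
-- replaces (nk)! by r!, a loss of at most a factor (nk)^k; the free signs repay it, since (nk)^k ≤
-- 2^((n-1)k) = 2^r.

module _ {v : ℕ} .{{_ : NonZero v}} where

  ι : ℕ → Fin v
  ι a = a mod v

  neg : Fin v → Fin v
  neg x = ι (v ∸ toℕ x)

  toℕ-ι : ∀ a → toℕ (ι a) ≡ a % v
  toℕ-ι a = toℕ-fromℕ< (m%n<n a v)

  toℕ-ι-< : ∀ {a} → a < v → toℕ (ι a) ≡ a
  toℕ-ι-< {a} a<v = trans (toℕ-ι a) (m<n⇒m%n≡m a<v)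

  ι-cong : ∀ {a b} → a % v ≡ b % v → ι a ≡ ι b
  ι-cong {a} {b} eq = toℕ-injective (trans (toℕ-ι a) (trans eq (sym (toℕ-ι b))))

  ι-injective : ∀ {a b} → a < v → b < v → ι a ≡ ι b → a ≡ b
  ι-injective a<v b<v eq = trans (sym (toℕ-ι-< a<v)) (trans (cong toℕ eq) (toℕ-ι-< b<v))

  ι-toℕ : ∀ x → ι (toℕ x) ≡ x
  ι-toℕ x = toℕ-injective (toℕ-ι-< (toℕ<n x))

  ι-+ : ∀ a b → ι (a + b) ≡ ι a ⊕ ι b
  ι-+ a b = ι-cong (begin
    (a + b) % v                        ≡⟨ %-distribˡ-+ a b v ⟩
    (a % v + b % v) % v                ≡⟨ cong₂ (λ r s → (r + s) % v) (toℕ-ι a) (toℕ-ι b) ⟨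
    (toℕ (ι a) + toℕ (ι b)) % v        ∎)

  ι-v : ι v ≡ ι 0
  ι-v = ι-cong (trans (n%n≡0 v) (sym (m*n%n≡0 0 v)))

  ⊕-comm : ∀ x y → x ⊕ y ≡ y ⊕ x
  ⊕-comm x y = cong ι (+-comm (toℕ x) (toℕ y))

  ⊕-assoc : ∀ x y z → (x ⊕ y) ⊕ z ≡ x ⊕ (y ⊕ z)
  ⊕-assoc x y z = begin
    ι (a + b) ⊕ z       ≡⟨ cong (ι (a + b) ⊕_) (ι-toℕ z) ⟨
    ι (a + b) ⊕ ι c     ≡⟨ ι-+ (a + b) c ⟨
    ι (a + b + c)       ≡⟨ cong ι (+-assoc a b c) ⟩
    ι (a + (b + c))     ≡⟨ ι-+ a (b + c) ⟩
    ι a ⊕ ι (b + c)     ≡⟨ cong (_⊕ ι (b + c)) (ι-toℕ x) ⟩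
    x ⊕ ι (b + c)       ∎
    where
    a = toℕ x
    b = toℕ y
    c = toℕ z

  ⊕-identityˡ : ∀ x → ι 0 ⊕ x ≡ x
  ⊕-identityˡ x = begin
    ι 0 ⊕ x             ≡⟨ cong (ι 0 ⊕_) (ι-toℕ x) ⟨
    ι 0 ⊕ ι (toℕ x)     ≡⟨ ι-+ 0 (toℕ x) ⟨
    ι (toℕ x)           ≡⟨ ι-toℕ x ⟩
    x                   ∎

  ⊕-inverseˡ : ∀ x → neg x ⊕ x ≡ ι 0
  ⊕-inverseˡ x = begin
    ι (v ∸ toℕ x) ⊕ x            ≡⟨ cong (neg x ⊕_) (ι-toℕ x) ⟨
    ι (v ∸ toℕ x) ⊕ ι (toℕ x)    ≡⟨ ι-+ (v ∸ toℕ x) (toℕ x) ⟨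
    ι (v ∸ toℕ x + toℕ x)        ≡⟨ cong ι (m∸n+n≡m (<⇒≤ (toℕ<n x))) ⟩
    ι v                          ≡⟨ ι-v ⟩
    ι 0                          ∎

  ⊖≡⊕neg : ∀ x y → x ⊖ y ≡ x ⊕ neg y
  ⊖≡⊕neg x y = begin
    ι (toℕ x + (v ∸ toℕ y))      ≡⟨ ι-+ (toℕ x) (v ∸ toℕ y) ⟩
    ι (toℕ x) ⊕ neg y            ≡⟨ cong (_⊕ neg y) (ι-toℕ x) ⟩
    x ⊕ neg y                    ∎

  ⊕-isAbelianGroup : IsAbelianGroup _≡_ _⊕_ (ι 0) neg
  ⊕-isAbelianGroup = record
    { isGroup = record
      { isMonoid = record
        { isSemigroup = record
          { isMagma = record { isEquivalence = isEquivalence ; ∙-cong = cong₂ _⊕_ }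
          ; assoc = ⊕-assoc
          }
        ; identity = comm∧idˡ⇒id ⊕-comm ⊕-identityˡ
        }
      ; inverse = comm∧invˡ⇒inv ⊕-comm ⊕-inverseˡ
      ; ⁻¹-cong = cong neg
      }
    ; comm = ⊕-comm
    }

ℤ/ : (v : ℕ) .{{_ : NonZero v}} → AbelianGroup 0ℓ 0ℓ
ℤ/ v = record { isAbelianGroup = ⊕-isAbelianGroup {v} }

module _ {v : ℕ} .{{_ : NonZero v}} where

  open AbelianGroup (ℤ/ v) using () renaming (identityʳ to ⊕-identityʳ; inverseʳ to ⊕-inverseʳ) public
  open AbelianGroupProperties (ℤ/ v) using (⁻¹-∙-comm)
    renaming (⁻¹-involutive to neg-involutive; ∙-cancelˡ to ⊕-cancelˡ; ∙-cancelʳ to ⊕-cancelʳ) public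

  neg-⊕ : ∀ (x y : Fin v) → neg (x ⊕ y) ≡ neg x ⊕ neg y
  neg-⊕ x y = sym (⁻¹-∙-comm x y)

  [x⊕y]⊖x≡y : ∀ (x y : Fin v) → (x ⊕ y) ⊖ x ≡ y
  [x⊕y]⊖x≡y x y = begin
    (x ⊕ y) ⊖ x         ≡⟨ ⊖≡⊕neg (x ⊕ y) x ⟩
    (x ⊕ y) ⊕ neg x     ≡⟨ ⊕-comm (x ⊕ y) (neg x) ⟩
    neg x ⊕ (x ⊕ y)     ≡⟨ ⊕-assoc (neg x) x y ⟨
    (neg x ⊕ x) ⊕ y     ≡⟨ cong (_⊕ y) (⊕-inverseˡ x) ⟩
    ι 0 ⊕ y             ≡⟨ ⊕-identityˡ y ⟩
    y                   ∎

  [x⊕y]⊕neg-y≡x : ∀ (x y : Fin v) → (x ⊕ y) ⊕ neg y ≡ x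
  [x⊕y]⊕neg-y≡x x y = begin
    (x ⊕ y) ⊕ neg y     ≡⟨ ⊕-assoc x y (neg y) ⟩
    x ⊕ (y ⊕ neg y)     ≡⟨ cong (x ⊕_) (⊕-inverseʳ y) ⟩
    x ⊕ ι 0             ≡⟨ ⊕-identityʳ x ⟩
    x                   ∎

  [x⊕neg-y]⊕y≡x : ∀ (x y : Fin v) → (x ⊕ neg y) ⊕ y ≡ x
  [x⊕neg-y]⊕y≡x x y = begin
    (x ⊕ neg y) ⊕ y              ≡⟨ cong ((x ⊕ neg y) ⊕_) (neg-involutive y) ⟨
    (x ⊕ neg y) ⊕ neg (neg y)    ≡⟨ [x⊕y]⊕neg-y≡x x (neg y) ⟩
    x                            ∎

  x⊕[y⊖x]≡y : ∀ (x y : Fin v) → x ⊕ (y ⊖ x) ≡ y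
  x⊕[y⊖x]≡y x y = begin
    x ⊕ (y ⊖ x)         ≡⟨ cong (x ⊕_) (⊖≡⊕neg y x) ⟩
    x ⊕ (y ⊕ neg x)     ≡⟨ ⊕-comm x (y ⊕ neg x) ⟩
    (y ⊕ neg x) ⊕ x     ≡⟨ [x⊕neg-y]⊕y≡x y x ⟩
    y                   ∎

  x⊖[x⊕y]≡neg-y : ∀ (x y : Fin v) → x ⊖ (x ⊕ y) ≡ neg y
  x⊖[x⊕y]≡neg-y x y = begin
    x ⊖ (x ⊕ y)               ≡⟨ cong (_⊖ (x ⊕ y)) ([x⊕y]⊕neg-y≡x x y) ⟨
    ((x ⊕ y) ⊕ neg y) ⊖ (x ⊕ y) ≡⟨ [x⊕y]⊖x≡y (x ⊕ y) (neg y) ⟩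
    neg y                     ∎

  ⊕-⊖-cancelʳ : ∀ (x y g : Fin v) → (x ⊕ g) ⊖ (y ⊕ g) ≡ x ⊖ y
  ⊕-⊖-cancelʳ x y g = begin
    (x ⊕ g) ⊖ (y ⊕ g)               ≡⟨ cong (λ z → (z ⊕ g) ⊖ (y ⊕ g)) (x⊕[y⊖x]≡y y x) ⟨
    ((y ⊕ (x ⊖ y)) ⊕ g) ⊖ (y ⊕ g)   ≡⟨ cong (_⊖ (y ⊕ g)) (begin
      (y ⊕ (x ⊖ y)) ⊕ g   ≡⟨ ⊕-assoc y (x ⊖ y) g ⟩
      y ⊕ ((x ⊖ y) ⊕ g)   ≡⟨ cong (y ⊕_) (⊕-comm (x ⊖ y) g) ⟩
      y ⊕ (g ⊕ (x ⊖ y))   ≡⟨ ⊕-assoc y g (x ⊖ y) ⟨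
      (y ⊕ g) ⊕ (x ⊖ y)   ∎) ⟩
    ((y ⊕ g) ⊕ (x ⊖ y)) ⊖ (y ⊕ g)   ≡⟨ [x⊕y]⊖x≡y (y ⊕ g) (x ⊖ y) ⟩
    x ⊖ y                           ∎

-- Orbits of a map

module _ {A : Set} where

  iterate-+ : ∀ (f : A → A) x m n → iterate f x (m + n) ≡ iterate f (iterate f x m) n
  iterate-+ f x zero    n = refl
  iterate-+ f x (suc m) n = iterate-+ f (f x) m n

  iterate-map : ∀ {B : Set} {f : A → A} {g : B → B} {h : A → B} → (∀ x → h (f x) ≡ g (h x)) →
                ∀ x n → h (iterate f x n) ≡ iterate g (h x) n
  iterate-map         h∘f≗g∘h x zero    = refl
  iterate-map {f = f} {g} h∘f≗g∘h x (suc n) =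
    trans (iterate-map h∘f≗g∘h (f x) n) (cong (λ y → iterate g y n) (h∘f≗g∘h x))

  iterate-injective : ∀ {f : A → A} → (∀ {x y} → f x ≡ f y → x ≡ y) →
                      ∀ n {x y} → iterate f x n ≡ iterate f y n → x ≡ y
  iterate-injective inj zero    eq = eq
  iterate-injective inj (suc n) eq = inj (iterate-injective inj n eq)

least : ∀ {P : ℕ → Set} → Decidable P → ∀ n → P n → ∃[ l ] P l × (∀ j → j < l → ¬ P j)
least {P} P? = <-rec (λ n → P n → ∃[ l ] P l × (∀ j → j < l → ¬ P j)) step
  where
  step : ∀ n → (∀ {m} → m < n → P m → ∃[ l ] P l × (∀ j → j < l → ¬ P j)) →
         P n → ∃[ l ] P l × (∀ j → j < l → ¬ P j)
  step n rec Pn with anyUpTo? P? n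
  ... | yes (m , m<n , Pm) = rec m<n Pm
  ... | no  none           = n , Pn , λ j j<n Pj → none (j , j<n , Pj)

-- The coding makes `A` finite, so two of the iterates with numbers 0 to K coincide; injectivity of
-- `f` cancels the common start and leaves the period j - i, written `suc (toℕ j ∸ suc (toℕ i))`.
-- Searching among periods `suc l` keeps the minimum positive.
minimalPeriod : ∀ {A : Set} {K} (code : A → Fin K) → (∀ {x y} → code x ≡ code y → x ≡ y) →
                (f : A → A) → (∀ {x y} → f x ≡ f y → x ≡ y) →
                ∀ x → ∃[ l ] 0 < l × iterate f x l ≡ x × (∀ j → 0 < j → j < l → iterate f x j ≢ x)
minimalPeriod {A} {K} code code-inj f f-inj x
  with i , j , i<j , eq ← pigeonhole (n<1+n K) (λ i → code (iterate f x (toℕ i)))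
  with l , returns , minimal ← least (λ l → map′ code-inj (cong code) (code (iterate f x (suc l)) ≟ᶠ code x))
                                     (toℕ j ∸ suc (toℕ i))
                                     (iterate-injective f-inj (toℕ i) (begin
         iterate f (iterate f x (suc (toℕ j ∸ suc (toℕ i)))) (toℕ i)  ≡⟨ iterate-+ f x (suc (toℕ j ∸ suc (toℕ i))) (toℕ i) ⟨
         iterate f x (suc (toℕ j ∸ suc (toℕ i)) + toℕ i)              ≡⟨ cong (iterate f x) (+-suc (toℕ j ∸ suc (toℕ i)) (toℕ i)) ⟨
         iterate f x (toℕ j ∸ suc (toℕ i) + suc (toℕ i))              ≡⟨ cong (iterate f x) (m∸n+n≡m i<j) ⟩
         iterate f x (toℕ j)                                          ≡⟨ code-inj eq ⟨
         iterate f x (toℕ i)                                          ∎))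
  = suc l , z<s , returns , λ { (suc j) _ 1+j<1+l → minimal j (s≤s⁻¹ 1+j<1+l) }

-- Congruences

m%d≡n%d⇒m%e≡n%e : ∀ {d e m n} .{{_ : NonZero d}} .{{_ : NonZero e}} → e ∣ d →
                  m % d ≡ n % d → m % e ≡ n % e
m%d≡n%d⇒m%e≡n%e {d} {e} {m} {n} e∣d eq = begin
  m % e       ≡⟨ m∣n⇒o%n%m≡o%m e d m e∣d ⟨
  m % d % e   ≡⟨ cong (_% e) eq ⟩
  n % d % e   ≡⟨ m∣n⇒o%n%m≡o%m e d n e∣d ⟩
  n % e       ∎

%-congʳ-+ : ∀ {d m n} .{{_ : NonZero d}} a → m % d ≡ n % d → (m + a) % d ≡ (n + a) % d
%-congʳ-+ {d} {m} {n} a eq = begin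
  (m + a) % d           ≡⟨ %-distribˡ-+ m a d ⟩
  (m % d + a % d) % d   ≡⟨ cong (λ r → (r + a % d) % d) eq ⟩
  (n % d + a % d) % d   ≡⟨ %-distribˡ-+ n a d ⟨
  (n + a) % d           ∎

[m+n]%d≡m%d⇒d∣n : ∀ m n d .{{_ : NonZero d}} → (m + n) % d ≡ m % d → d ∣ n
[m+n]%d≡m%d⇒d∣n m n d eq = ∣m+n∣m⇒∣n
  (divides ((m + n) / d) (+-cancelˡ-≡ (m % d) _ _ (begin
    m % d + (m / d * d + n)              ≡⟨ +-assoc (m % d) (m / d * d) n ⟨
    m % d + m / d * d + n                ≡⟨ cong (_+ n) (m≡m%n+[m/n]*n m d) ⟨
    m + n                                ≡⟨ m≡m%n+[m/n]*n (m + n) d ⟩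
    (m + n) % d + (m + n) / d * d        ≡⟨ cong (_+ (m + n) / d * d) eq ⟩
    m % d + (m + n) / d * d              ∎)))
  (divides (m / d) refl)

-- Since d divides M, reduction modulo d is well defined on ℤ_M; parity and residues modulo k of
-- positions rest on this.
%-⊕ : ∀ {M d} .{{_ : NonZero M}} .{{_ : NonZero d}} → d ∣ M → ∀ (p : Fin M) a →
      toℕ (p ⊕ ι a) % d ≡ (toℕ p + a) % d
%-⊕ {M} {d} d∣M p a = begin
  toℕ (p ⊕ ι a) % d          ≡⟨ cong (λ q → toℕ (q ⊕ ι a) % d) (ι-toℕ p) ⟨
  toℕ (ι (toℕ p) ⊕ ι a) % d  ≡⟨ cong (λ q → toℕ q % d) (ι-+ (toℕ p) a) ⟨
  toℕ (ι {M} (toℕ p + a)) % d ≡⟨ cong (_% d) (toℕ-ι {M} (toℕ p + a)) ⟩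
  (toℕ p + a) % M % d        ≡⟨ m∣n⇒o%n%m≡o%m d M (toℕ p + a) d∣M ⟩
  (toℕ p + a) % d            ∎

∈⟨⟩-⊕ : ∀ {v} .{{_ : NonZero v}} d {x y : Fin v} → x ∈⟨ d ⟩ → y ∈⟨ d ⟩ → (x ⊕ y) ∈⟨ d ⟩
∈⟨⟩-⊕ {v} d {x} {y} (i , x≡) (j , y≡) = i + j , sum
  where
  sum : x ⊕ y ≡ ι ((i + j) * d)
  sum = begin
    x ⊕ y                     ≡⟨ cong₂ _⊕_ x≡ y≡ ⟩
    ι (i * d) ⊕ ι (j * d)     ≡⟨ ι-+ (i * d) (j * d) ⟨
    ι (i * d + j * d)         ≡⟨ cong ι (*-distribʳ-+ d i j) ⟨
    ι ((i + j) * d)           ∎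

-- A listing b of ℤ_v ∖ J in the cyclic order ℤ_M; negation is the involution star.

record NeighbourCycle (v t M : ℕ) .{{_ : NonZero v}} .{{_ : NonZero t}} .{{_ : NonZero M}} : Set where
  field
    b      : Fin M → Fin v
    pos    : Fin v → Fin M
    star   : Fin M → Fin M
    b∉J    : ∀ p → ¬ (b p ∈⟨ v / t ⟩)
    pos-b  : ∀ p → pos (b p) ≡ p
    b-pos  : ∀ d → ¬ (d ∈⟨ v / t ⟩) → b (pos d) ≡ d
    b-star : ∀ p → b (star p) ≡ neg (b p)
    ∈J?    : ∀ (d : Fin v) → Dec (d ∈⟨ v / t ⟩)
    1∉J    : ¬ (ι {v} 1 ∈⟨ v / t ⟩)

-- Translation-invariant embeddings and their faces

module Rotational {v t M : ℕ} .{{_ : NonZero v}} .{{_ : NonZero t}} .{{_ : NonZero M}}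
                  (B : NeighbourCycle v t M) where

  open NeighbourCycle B public

  Γ : SimpleGraph v
  Γ = completeMultipartite v t

  b-injective : ∀ {p q} → b p ≡ b q → p ≡ q
  b-injective {p} {q} eq = trans (sym (pos-b p)) (trans (cong pos eq) (pos-b q))

  star-involutive : ∀ p → star (star p) ≡ p
  star-involutive p = b-injective (begin
    b (star (star p))   ≡⟨ b-star (star p) ⟩
    neg (b (star p))    ≡⟨ cong neg (b-star p) ⟩
    neg (neg (b p))     ≡⟨ neg-involutive (b p) ⟩
    b p                 ∎)

  dart-≡ : ∀ {d e : Dart Γ} → src d ≡ src e → tgt d ≡ tgt e → d ≡ e
  dart-≡ refl refl = refl

  mk : Fin v → Fin M → Dart Γ
  mk x p = dart x (x ⊕ b p)
    (subst (λ d → ¬ (d ∈⟨ v / t ⟩)) (sym (trans (x⊖[x⊕y]≡neg-y x (b p)) (sym (b-star p)))) (b∉J (star p)))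

  ppos : Dart Γ → Fin M
  ppos d = pos (tgt d ⊖ src d)

  ppos-mk : ∀ x p → ppos (mk x p) ≡ p
  ppos-mk x p = trans (cong pos ([x⊕y]⊖x≡y x (b p))) (pos-b p)

  -- The adjacency proof of a dart is irrelevant and cannot be handed to `b-pos`. Membership in J is
  -- therefore decided afresh, and the irrelevant proof only refutes the impossible case.
  mk-ppos : ∀ d → mk (src d) (ppos d) ≡ d
  mk-ppos (dart x y x∼y) with ∈J? (y ⊖ x)
  ... | yes y⊖x∈J = ⊥-elim-irr (x∼y (⊖-swap-∈ (v / t) y x y⊖x∈J))
  ... | no  y⊖x∉J = dart-≡ refl (trans (cong (x ⊕_) (b-pos (y ⊖ x) y⊖x∉J)) (x⊕[y⊖x]≡y x y))

  turn turn⁻¹ : Dart Γ → Dart Γ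
  turn   d = mk (src d) (ppos d ⊕ ι 1)
  turn⁻¹ d = mk (src d) (ppos d ⊕ neg (ι 1))

  turn-mk : ∀ x p → turn (mk x p) ≡ mk x (p ⊕ ι 1)
  turn-mk x p = cong (λ q → mk x (q ⊕ ι 1)) (ppos-mk x p)

  turn⁻¹-mk : ∀ x p → turn⁻¹ (mk x p) ≡ mk x (p ⊕ neg (ι 1))
  turn⁻¹-mk x p = cong (λ q → mk x (q ⊕ neg (ι 1))) (ppos-mk x p)

  turn-turn⁻¹ : ∀ d → turn (turn⁻¹ d) ≡ d
  turn-turn⁻¹ d = begin
    turn (turn⁻¹ d)                                ≡⟨ turn-mk (src d) (ppos d ⊕ neg (ι 1)) ⟩
    mk (src d) ((ppos d ⊕ neg (ι 1)) ⊕ ι 1)        ≡⟨ cong (mk (src d)) ([x⊕neg-y]⊕y≡x (ppos d) (ι 1)) ⟩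
    mk (src d) (ppos d)                            ≡⟨ mk-ppos d ⟩
    d                                              ∎

  turn⁻¹-turn : ∀ d → turn⁻¹ (turn d) ≡ d
  turn⁻¹-turn d = begin
    turn⁻¹ (turn d)                                ≡⟨ turn⁻¹-mk (src d) (ppos d ⊕ ι 1) ⟩
    mk (src d) ((ppos d ⊕ ι 1) ⊕ neg (ι 1))        ≡⟨ cong (mk (src d)) ([x⊕y]⊕neg-y≡x (ppos d) (ι 1)) ⟩
    mk (src d) (ppos d)                            ≡⟨ mk-ppos d ⟩
    d                                              ∎

  turnⁱ : ∀ i x p → iterate turn (mk x p) i ≡ mk x (p ⊕ ι i)
  turnⁱ zero    x p = cong (mk x) (sym (⊕-identityʳ p))
  turnⁱ (suc i) x p = begin
    iterate turn (turn (mk x p)) i       ≡⟨ cong (λ d → iterate turn d i) (turn-mk x p) ⟩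
    iterate turn (mk x (p ⊕ ι 1)) i      ≡⟨ turnⁱ i x (p ⊕ ι 1) ⟩
    mk x ((p ⊕ ι 1) ⊕ ι i)               ≡⟨ cong (mk x) (⊕-assoc p (ι 1) (ι i)) ⟩
    mk x (p ⊕ (ι 1 ⊕ ι i))               ≡⟨ cong (λ q → mk x (p ⊕ q)) (ι-+ 1 i) ⟨
    mk x (p ⊕ ι (suc i))                 ∎

  -- Since 1 ∉ J, a vertex is adjacent to its successor; if x and y lie in the same part, then x + 1
  -- is a common neighbour.
  connected : Connected Γ
  connected x y with ∈J? (x ⊖ y)
  ... | no  x∼y   = x∼y ◅ []⋆
  ... | yes x⊖y∈J = x∼x⊕1 ◅ x⊕1∼y ◅ []⋆
    where
    z = x ⊕ ι 1
    x∼x⊕1 : ¬ ((x ⊖ z) ∈⟨ v / t ⟩)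
    x∼x⊕1 x⊖z∈J = 1∉J (subst (_∈⟨ v / t ⟩) ([x⊕y]⊖x≡y x (ι 1)) (⊖-swap-∈ (v / t) x z x⊖z∈J))
    x⊕1∼y : ¬ ((z ⊖ y) ∈⟨ v / t ⟩)
    x⊕1∼y z⊖y∈J = x∼x⊕1 (subst (_∈⟨ v / t ⟩) (begin
      (x ⊖ y) ⊕ (y ⊖ z)              ≡⟨ cong (_⊕ (y ⊖ z)) (⊖≡⊕neg x y) ⟩
      (x ⊕ neg y) ⊕ (y ⊖ z)          ≡⟨ cong ((x ⊕ neg y) ⊕_) (⊖≡⊕neg y z) ⟩
      (x ⊕ neg y) ⊕ (y ⊕ neg z)      ≡⟨ ⊕-assoc (x ⊕ neg y) y (neg z) ⟨
      ((x ⊕ neg y) ⊕ y) ⊕ neg z      ≡⟨ cong (_⊕ neg z) ([x⊕neg-y]⊕y≡x x y) ⟩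
      x ⊕ neg z                      ≡⟨ ⊖≡⊕neg x z ⟨
      x ⊖ z                          ∎)
      (∈⟨⟩-⊕ (v / t) x⊖y∈J (⊖-swap-∈ (v / t) z y z⊖y∈J)))

  Π : Embedding Γ
  Π = record
    { connected    = connected
    ; rotation     = mk↔ₛ′ turn turn⁻¹ turn-turn⁻¹ turn⁻¹-turn
    ; preserve-src = λ _ → refl
    ; cyclic       = reach
    }
    where
    reach : ∀ d e → src d ≡ src e → ∃[ i ] iterate turn d i ≡ e
    reach d e same = toℕ (ppos e ⊖ ppos d) , (begin
      iterate turn d i                           ≡⟨ cong (λ d → iterate turn d i) (mk-ppos d) ⟨
      iterate turn (mk (src d) (ppos d)) i       ≡⟨ turnⁱ i (src d) (ppos d) ⟩
      mk (src d) (ppos d ⊕ ι i)                  ≡⟨ cong₂ mk same (begin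
        ppos d ⊕ ι i                      ≡⟨ cong (ppos d ⊕_) (ι-toℕ (ppos e ⊖ ppos d)) ⟩
        ppos d ⊕ (ppos e ⊖ ppos d)        ≡⟨ x⊕[y⊖x]≡y (ppos d) (ppos e) ⟩
        ppos e                            ∎) ⟩
      mk (src e) (ppos e)                        ≡⟨ mk-ppos e ⟩
      e                                          ∎)
      where i = toℕ (ppos e ⊖ ppos d)

  F : Dart Γ → Dart Γ
  F = faceStep Π

  -- The effect of a face step on positions. It does not involve the vertex, so much of the face
  -- analysis takes place in ℤ_M.
  φ : Fin M → Fin M
  φ p = star p ⊕ ι 1

  reverse-mk : ∀ x p → reverse (mk x p) ≡ mk (x ⊕ b p) (star p)
  reverse-mk x p = dart-≡ refl (sym (begin
    (x ⊕ b p) ⊕ b (star p)     ≡⟨ cong ((x ⊕ b p) ⊕_) (b-star p) ⟩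
    (x ⊕ b p) ⊕ neg (b p)      ≡⟨ [x⊕y]⊕neg-y≡x x (b p) ⟩
    x                          ∎))

  F-mk : ∀ x p → F (mk x p) ≡ mk (x ⊕ b p) (φ p)
  F-mk x p = trans (cong turn (reverse-mk x p)) (turn-mk (x ⊕ b p) (star p))

  ppos-reverse : ∀ d → ppos (reverse d) ≡ star (ppos d)
  ppos-reverse d = begin
    ppos (reverse d)                           ≡⟨ cong (ppos ∘ reverse) (mk-ppos d) ⟨
    ppos (reverse (mk (src d) (ppos d)))       ≡⟨ cong ppos (reverse-mk (src d) (ppos d)) ⟩
    ppos (mk (src d ⊕ b (ppos d)) (star (ppos d)))     ≡⟨ ppos-mk (src d ⊕ b (ppos d)) (star (ppos d)) ⟩
    star (ppos d)                              ∎

  ppos-F : ∀ d → ppos (F d) ≡ φ (ppos d)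
  ppos-F d = trans (ppos-mk (src (reverse d)) (ppos (reverse d) ⊕ ι 1)) (cong (_⊕ ι 1) (ppos-reverse d))

  F-injective : ∀ {d e} → F d ≡ F e → d ≡ e
  -- Reversing twice is definitionally the identity, by eta and irrelevance of adjacency, so an
  -- equality of reversed darts suffices.
  F-injective {d} {e} eq = cong reverse {reverse d} {reverse e} (begin
    reverse d                  ≡⟨ turn⁻¹-turn (reverse d) ⟨
    turn⁻¹ (F d)               ≡⟨ cong turn⁻¹ eq ⟩
    turn⁻¹ (F e)               ≡⟨ turn⁻¹-turn (reverse e) ⟩
    reverse e                  ∎)

  dartCode : Dart Γ → Fin (v * M)
  dartCode d = combine (src d) (ppos d)

  dartCode-injective : ∀ {d e} → dartCode d ≡ dartCode e → d ≡ e
  dartCode-injective {d} {e} eq = begin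
    d                          ≡⟨ mk-ppos d ⟨
    mk (src d) (ppos d)        ≡⟨ cong₂ mk (combine-injectiveˡ (src d) (ppos d) (src e) (ppos e) eq)
                                           (combine-injectiveʳ (src d) (ppos d) (src e) (ppos e) eq) ⟩
    mk (src e) (ppos e)        ≡⟨ mk-ppos e ⟩
    e                          ∎

  module _ {k : ℕ} .{{_ : NonZero k}} .{{_ : NonZero (2 * k)}} (2k∣M : 2 * k ∣ M) (k-odd : k % 2 ≡ 1)
           (star-mod : ∀ p → toℕ (star p) % (2 * k) ≡ (toℕ p + k) % (2 * k)) where

    -- Modulo k the involution does nothing, so every face step advances the position by exactly
    -- one. The position modulo k is a clock, and a return to the initial dart takes a multiple of k
    -- steps.
    faceLengths : FaceLengthsMultipleOf k Π
    faceLengths d = l , proj₂ period ,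
      [m+n]%d≡m%d⇒d∣n (toℕ (ppos d)) l k
        (trans (sym (clock l d)) (cong (λ e → toℕ (ppos e) % k) (proj₁ (proj₂ (proj₂ period)))))
      where
      period : ∃[ l ] IsFaceLength Π d l
      period = minimalPeriod dartCode dartCode-injective F F-injective d
      l : ℕ
      l = proj₁ period
      k∣M : k ∣ M
      k∣M = ∣-trans (n∣m*n 2) 2k∣M
      tick : ∀ d → toℕ (ppos (F d)) % k ≡ (toℕ (ppos d) + 1) % k
      tick d = begin
        toℕ (ppos (F d)) % k               ≡⟨ cong (λ p → toℕ p % k) (ppos-F d) ⟩
        toℕ (star p ⊕ ι 1) % k             ≡⟨ %-⊕ k∣M (star p) 1 ⟩
        (toℕ (star p) + 1) % k             ≡⟨ %-congʳ-+ {m = toℕ (star p)} 1 (m%d≡n%d⇒m%e≡n%e (n∣m*n 2) (star-mod p)) ⟩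
        (toℕ p + k + 1) % k                ≡⟨ %-congʳ-+ {m = toℕ p + k} 1 ([m+n]%n≡m%n (toℕ p) k) ⟩
        (toℕ p + 1) % k                    ∎
        where p = ppos d
      clock : ∀ i d → toℕ (ppos (iterate F d i)) % k ≡ (toℕ (ppos d) + i) % k
      clock zero    d = cong (_% k) (sym (+-identityʳ (toℕ (ppos d))))
      clock (suc i) d = begin
        toℕ (ppos (iterate F (F d) i)) % k     ≡⟨ clock i (F d) ⟩
        (toℕ (ppos (F d)) + i) % k             ≡⟨ %-congʳ-+ {m = toℕ (ppos (F d))} i (tick d) ⟩
        (toℕ (ppos d) + 1 + i) % k             ≡⟨ cong (_% k) (+-assoc (toℕ (ppos d)) 1 i) ⟩
        (toℕ (ppos d) + suc i) % k             ∎

    -- As k is odd, `star` changes the parity of a position, so the two sides of an edge differ in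
    -- colour; the increment that completes a face step changes it back.
    biembedding : IsBiembedding Π
    biembedding = (λ d → toℕ (ppos d) % 2 ≡ᵇ 0) , same , differ
      where
      2∣M : 2 ∣ M
      2∣M = ∣-trans (m∣m*n k) 2k∣M
      star-mod-2 : ∀ p → toℕ (star p) % 2 ≡ (toℕ p + 1) % 2
      star-mod-2 p = begin
        toℕ (star p) % 2             ≡⟨ m%d≡n%d⇒m%e≡n%e (m∣m*n k) (star-mod p) ⟩
        (toℕ p + k) % 2              ≡⟨ cong (_% 2) (+-comm (toℕ p) k) ⟩
        (k + toℕ p) % 2              ≡⟨ %-congʳ-+ {m = k} {n = 1} (toℕ p) k-odd ⟩
        (1 + toℕ p) % 2              ≡⟨ cong (_% 2) (+-comm 1 (toℕ p)) ⟩
        (toℕ p + 1) % 2              ∎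
      same : ∀ d → (toℕ (ppos (F d)) % 2 ≡ᵇ 0) ≡ (toℕ (ppos d) % 2 ≡ᵇ 0)
      same d = cong (_≡ᵇ 0) (begin
        toℕ (ppos (F d)) % 2               ≡⟨ cong (λ p → toℕ p % 2) (ppos-F d) ⟩
        toℕ (star (ppos d) ⊕ ι 1) % 2      ≡⟨ %-⊕ 2∣M (star (ppos d)) 1 ⟩
        (toℕ (star (ppos d)) + 1) % 2      ≡⟨ %-congʳ-+ {m = toℕ (star (ppos d))} {n = toℕ (ppos d) + 1} 1 (star-mod-2 (ppos d)) ⟩
        (toℕ (ppos d) + 1 + 1) % 2         ≡⟨ cong (_% 2) (+-assoc (toℕ (ppos d)) 1 1) ⟩
        (toℕ (ppos d) + 2) % 2             ≡⟨ [m+n]%n≡m%n (toℕ (ppos d)) 2 ⟩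
        toℕ (ppos d) % 2                   ∎)
      flips : ∀ a → ((a + 1) % 2 ≡ᵇ 0) ≢ (a % 2 ≡ᵇ 0)
      flips zero          ()
      flips (suc zero)    ()
      flips (suc (suc a)) eq = flips a (begin
        ((a + 1) % 2 ≡ᵇ 0)               ≡⟨ cong (_≡ᵇ 0) ([m+n]%n≡m%n (a + 1) 2) ⟨
        ((a + 1 + 2) % 2 ≡ᵇ 0)           ≡⟨ cong (λ c → c % 2 ≡ᵇ 0) (+-comm (a + 1) 2) ⟩
        (suc (suc a + 1) % 2 ≡ᵇ 0)       ≡⟨ eq ⟩
        (suc (suc a) % 2 ≡ᵇ 0)           ≡⟨ cong (λ c → c % 2 ≡ᵇ 0) (+-comm 2 a) ⟩
        ((a + 2) % 2 ≡ᵇ 0)               ≡⟨ cong (_≡ᵇ 0) ([m+n]%n≡m%n a 2) ⟩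
        (a % 2 ≡ᵇ 0)                     ∎)
      differ : ∀ d → (toℕ (ppos (reverse d)) % 2 ≡ᵇ 0) ≢ (toℕ (ppos d) % 2 ≡ᵇ 0)
      differ d eq = flips (toℕ (ppos d)) (trans (sym (begin
        (toℕ (ppos (reverse d)) % 2 ≡ᵇ 0)        ≡⟨ cong (λ p → toℕ p % 2 ≡ᵇ 0) (ppos-reverse d) ⟩
        (toℕ (star (ppos d)) % 2 ≡ᵇ 0)           ≡⟨ cong (_≡ᵇ 0) (star-mod-2 (ppos d)) ⟩
        ((toℕ (ppos d) + 1) % 2 ≡ᵇ 0)            ∎)) eq)

-- Automorphisms

module Automorphisms {v t M : ℕ} .{{_ : NonZero v}} .{{_ : NonZero t}} .{{_ : NonZero M}}
                     (B : NeighbourCycle v t M) where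

  open Rotational B

  translation : Fin v → GraphAutomorphism Γ
  translation g = record
    { perm      = permutation (_⊕ g) (_⊕ neg g) (λ x → [x⊕neg-y]⊕y≡x x g) (λ x → [x⊕y]⊕neg-y≡x x g)
    ; preserves = λ x y → mk⇔
        (subst (λ d → ¬ (d ∈⟨ v / t ⟩)) (sym (⊕-⊖-cancelʳ x y g)))
        (subst (λ d → ¬ (d ∈⟨ v / t ⟩)) (⊕-⊖-cancelʳ x y g))
    }

  translation-mk : ∀ g x p → onDarts (translation g) (mk x p) ≡ mk (x ⊕ g) p
  translation-mk g x p = dart-≡ refl (begin
    (x ⊕ b p) ⊕ g       ≡⟨ ⊕-assoc x (b p) g ⟩
    x ⊕ (b p ⊕ g)       ≡⟨ cong (x ⊕_) (⊕-comm (b p) g) ⟩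
    x ⊕ (g ⊕ b p)       ≡⟨ ⊕-assoc x g (b p) ⟨
    (x ⊕ g) ⊕ b p       ∎)

  translation-isAutomorphism : ∀ g → IsAutomorphism Π (translation g)
  translation-isAutomorphism g = inj₁ λ d → begin
    onDarts (translation g) (turn d)                     ≡⟨ translation-mk g (src d) (ppos d ⊕ ι 1) ⟩
    mk (src d ⊕ g) (ppos d ⊕ ι 1)                        ≡⟨ cong (λ z → mk (src d ⊕ g) (pos z ⊕ ι 1)) (⊕-⊖-cancelʳ (tgt d) (src d) g) ⟨
    turn (onDarts (translation g) d)                     ∎

  iterate-turn⁻¹ : ∀ i x p → iterate turn⁻¹ (mk x p) i ≡ mk x (p ⊕ neg (ι i))
  iterate-turn⁻¹ i x p = begin
    iterate turn⁻¹ (mk x p) i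
      ≡⟨ cong (λ q → iterate turn⁻¹ (mk x q) i) ([x⊕neg-y]⊕y≡x p (ι i)) ⟨
    iterate turn⁻¹ (mk x ((p ⊕ neg (ι i)) ⊕ ι i)) i
      ≡⟨ cong (λ d → iterate turn⁻¹ d i) (turnⁱ i x (p ⊕ neg (ι i))) ⟨
    iterate turn⁻¹ (iterate turn (mk x (p ⊕ neg (ι i))) i) i
      ≡⟨ undo i (mk x (p ⊕ neg (ι i))) ⟩
    mk x (p ⊕ neg (ι i)) ∎
    where
    undo : ∀ i d → iterate turn⁻¹ (iterate turn d i) i ≡ d
    undo zero    d = refl
    undo (suc i) d = begin
      iterate turn⁻¹ (turn⁻¹ (iterate turn (turn d) i)) i
        ≡⟨ iterate-map {h = turn⁻¹} (λ _ → refl) (iterate turn (turn d) i) i ⟨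
      turn⁻¹ (iterate turn⁻¹ (iterate turn (turn d) i) i)
        ≡⟨ cong turn⁻¹ (undo i (turn d)) ⟩
      turn⁻¹ (turn d)
        ≡⟨ turn⁻¹-turn d ⟩
      d ∎

  module _ (σ : GraphAutomorphism Γ) where

    -- σ carries the rotation at x to the rotation at σ x, shifted by offset x.
    offset : Fin v → Fin M
    offset x = ppos (onDarts σ (mk x (ι 0)))

    image-of-first : ∀ x → onDarts σ (mk x (ι 0)) ≡ mk (onVertices σ x) (offset x)
    image-of-first x = sym (mk-ppos (onDarts σ (mk x (ι 0))))

    from-first : ∀ x i → iterate turn (mk x (ι 0)) i ≡ mk x (ι i)
    from-first x i = trans (turnⁱ i x (ι 0)) (cong (mk x) (⊕-identityˡ (ι i)))

    image-preserving : (∀ d → onDarts σ (turn d) ≡ turn (onDarts σ d)) →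
                       ∀ x i → onDarts σ (mk x (ι i)) ≡ mk (onVertices σ x) (offset x ⊕ ι i)
    image-preserving comm x i = begin
      onDarts σ (mk x (ι i))                               ≡⟨ cong (onDarts σ) (from-first x i) ⟨
      onDarts σ (iterate turn (mk x (ι 0)) i)              ≡⟨ iterate-map {h = onDarts σ} comm (mk x (ι 0)) i ⟩
      iterate turn (onDarts σ (mk x (ι 0))) i              ≡⟨ cong (λ d → iterate turn d i) (image-of-first x) ⟩
      iterate turn (mk (onVertices σ x) (offset x)) i      ≡⟨ turnⁱ i (onVertices σ x) (offset x) ⟩
      mk (onVertices σ x) (offset x ⊕ ι i)                 ∎

    image-reversing : (∀ d → onDarts σ (turn d) ≡ turn⁻¹ (onDarts σ d)) →
                      ∀ x i → onDarts σ (mk x (ι i)) ≡ mk (onVertices σ x) (offset x ⊕ neg (ι i))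
    image-reversing comm x i = begin
      onDarts σ (mk x (ι i))                               ≡⟨ cong (onDarts σ) (from-first x i) ⟨
      onDarts σ (iterate turn (mk x (ι 0)) i)              ≡⟨ iterate-map {h = onDarts σ} comm (mk x (ι 0)) i ⟩
      iterate turn⁻¹ (onDarts σ (mk x (ι 0))) i            ≡⟨ cong (λ d → iterate turn⁻¹ d i) (image-of-first x) ⟩
      iterate turn⁻¹ (mk (onVertices σ x) (offset x)) i    ≡⟨ iterate-turn⁻¹ i (onVertices σ x) (offset x) ⟩
      mk (onVertices σ x) (offset x ⊕ neg (ι i))           ∎

    closed-preserving : (∀ d → onDarts σ (turn d) ≡ turn (onDarts σ d)) →
                        ∀ k d → iterate F d k ≡ d → iterate F (onDarts σ d) k ≡ onDarts σ d
    closed-preserving comm k d closed = begin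
      iterate F (onDarts σ d) k      ≡⟨ iterate-map {h = onDarts σ} (λ d → comm (reverse d)) d k ⟨
      onDarts σ (iterate F d k)      ≡⟨ cong (onDarts σ) closed ⟩
      onDarts σ d                    ∎

    -- A reversing σ conjugates `F` into `G`, which uses the inverse rotation. Conjugated by
    -- `reverse`, `G` is the inverse of `F`: the image face is traversed backwards, on the opposite
    -- darts.
    closed-reversing : (∀ d → onDarts σ (turn d) ≡ turn⁻¹ (onDarts σ d)) →
                       ∀ k d → iterate F d k ≡ d →
                       iterate F (reverse (onDarts σ d)) k ≡ reverse (onDarts σ d)
    closed-reversing comm k d closed = begin
      iterate F (reverse (onDarts σ d)) k              ≡⟨ cong (λ e → iterate F (reverse e) k) (begin
        iterate G (onDarts σ d) k   ≡⟨ iterate-map {h = onDarts σ} (λ d → comm (reverse d)) d k ⟨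
        onDarts σ (iterate F d k)   ≡⟨ cong (onDarts σ) closed ⟩
        onDarts σ d                 ∎) ⟨
      iterate F (reverse (iterate G (onDarts σ d) k)) k  ≡⟨ retrace k (onDarts σ d) ⟩
      reverse (onDarts σ d)                              ∎
      where
      G : Dart Γ → Dart Γ
      G = turn⁻¹ ∘ reverse
      retrace : ∀ n e → iterate F (reverse (iterate G e n)) n ≡ reverse e
      retrace zero    e = refl
      retrace (suc n) e = begin
        iterate F (F (reverse (iterate G (G e) n))) n    ≡⟨ iterate-map {h = F} (λ _ → refl) (reverse (iterate G (G e) n)) n ⟨
        F (iterate F (reverse (iterate G (G e) n)) n)    ≡⟨ cong F (retrace n (G e)) ⟩
        turn (turn⁻¹ (reverse e))                        ≡⟨ turn-turn⁻¹ (reverse e) ⟩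
        reverse e                                        ∎

  -- The closed face walks of length suc e occupy odd positions below 2 (suc e),
  -- 1 and 2 e + 1 among them.  This leaves an automorphism one rotation and one
  -- reflection; the values of b at 0 and 2 e + 1 exclude the reflection.
  module _ (e : ℕ) (4k≤M : 4 * suc e ≤ M)
           (closed⇒odd : ∀ x p → iterate F (mk x p) (suc e) ≡ mk x p → ∃[ j ] j < suc e × toℕ p ≡ suc (2 * j))
           (closed-first : ∀ x → iterate F (mk x (ι 1)) (suc e) ≡ mk x (ι 1))
           (closed-last : ∀ x → iterate F (mk x (ι (suc (2 * e)))) (suc e) ≡ mk x (ι (suc (2 * e))))
           (star-odd : ∀ p j → j < suc e → toℕ p ≡ suc (2 * j) → ∃[ i ] i < suc e × toℕ (star p) ≡ 2 * i)
           (h : ℕ) (0<h : 0 < h) (8h<v : 8 * h < v)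
           (b-first : b (ι 0) ≡ neg (ι h)) (b-last : b (ι (suc (2 * e))) ≡ neg (ι (3 * h))) where

    private
      bound₁ : ∀ {j} → j < suc e → suc (2 * j) < M
      bound₁ {j} (s≤s j≤e) = ≤-trans (s≤s (s≤s (*-monoʳ-≤ 2 j≤e))) (≤-trans (≤-trans (m≤m+n (2 + 2 * e) (2 + 2 * e)) (≤-reflexive (double e))) 4k≤M)
        where
        double : ∀ e → (2 + 2 * e) + (2 + 2 * e) ≡ 4 * suc e
        double = solve-∀

      -- Two positions below 2k have a sum below 4k ≤ M, so nothing wraps around and equations
      -- between positions in ℤ_M may be read in ℕ.
      bound₂ : ∀ {j} → j < suc e → 2 * j + suc (2 * e) < M
      bound₂ {j} (s≤s j≤e) = ≤-trans (s≤s (+-monoˡ-≤ (suc (2 * e)) (*-monoʳ-≤ 2 j≤e))) (≤-trans (≤-trans (m≤m+n (suc (2 * e + suc (2 * e))) 2) (≤-reflexive (double e))) 4k≤M)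
        where
        double : ∀ e → suc (2 * e + suc (2 * e)) + 2 ≡ 4 * suc e
        double = solve-∀

      -- The position 2e + 1 is the largest admissible one, so only the zero shift keeps it
      -- admissible.
      ends : ∀ {i j} → j < suc e → 2 * i + suc (2 * e) ≡ suc (2 * j) → i ≡ 0 × j ≡ e
      ends {i} {j} (s≤s j≤e) eq = i≡0 , trans (sym i+e≡j) (cong (_+ e) i≡0)
        where
        i+e≡j : i + e ≡ j
        i+e≡j = *-cancelˡ-≡ (i + e) j 2 (suc-injective (trans (rearrange i e) eq))
          where
          rearrange : ∀ i e → suc (2 * (i + e)) ≡ 2 * i + suc (2 * e)
          rearrange = solve-∀
        i≡0 : i ≡ 0
        i≡0 = n≤0⇒n≡0 (+-cancelʳ-≤ e i 0 (≤-trans (≤-reflexive i+e≡j) j≤e))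

      toℕ≡⇒≡ι : ∀ (p : Fin M) {a} → toℕ p ≡ a → p ≡ ι a
      toℕ≡⇒≡ι p eq = trans (sym (ι-toℕ p)) (cong ι eq)

    -- Positions are shifted by c, and both 1 + c and 2e + 1 + c must be odd positions below 2k. The
    -- former gives c = 2i with i ≤ e; the latter leaves room for i = 0 only.
    offset-preserving : (σ : GraphAutomorphism Γ) → (∀ d → onDarts σ (turn d) ≡ turn (onDarts σ d)) →
                        ∀ x → offset σ x ≡ ι 0
    offset-preserving σ comm x = trans c≡ (cong (λ i → ι (2 * i)) (proj₁ (ends {i} {j} j<k same)))
      where
      c = offset σ x
      odd : ∀ a → iterate F (mk x (ι a)) (suc e) ≡ mk x (ι a) → ∃[ j ] j < suc e × toℕ (c ⊕ ι a) ≡ suc (2 * j)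
      odd a closed = closed⇒odd (onVertices σ x) (c ⊕ ι a)
        (subst (λ d → iterate F d (suc e) ≡ d) (image-preserving σ comm x a)
          (closed-preserving σ comm (suc e) (mk x (ι a)) closed))
      first = odd 1 (closed-first x)
      last = odd (suc (2 * e)) (closed-last x)
      i = proj₁ first
      j = proj₁ last
      i<k = proj₁ (proj₂ first)
      j<k = proj₁ (proj₂ last)
      c≡ : c ≡ ι (2 * i)
      c≡ = ⊕-cancelʳ (ι 1) c (ι (2 * i)) (begin
        c ⊕ ι 1                ≡⟨ toℕ≡⇒≡ι (c ⊕ ι 1) (proj₂ (proj₂ first)) ⟩
        ι (suc (2 * i))        ≡⟨ cong ι (+-comm 1 (2 * i)) ⟩
        ι (2 * i + 1)          ≡⟨ ι-+ (2 * i) 1 ⟩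
        ι (2 * i) ⊕ ι 1        ∎)
      same : 2 * i + suc (2 * e) ≡ suc (2 * j)
      same = ι-injective {M} (bound₂ i<k) (bound₁ j<k) (begin
        ι (2 * i + suc (2 * e))        ≡⟨ ι-+ (2 * i) (suc (2 * e)) ⟩
        ι (2 * i) ⊕ ι (suc (2 * e))    ≡⟨ cong (_⊕ ι (suc (2 * e))) c≡ ⟨
        c ⊕ ι (suc (2 * e))            ≡⟨ toℕ≡⇒≡ι (c ⊕ ι (suc (2 * e))) (proj₂ (proj₂ last)) ⟩
        ι (suc (2 * j))                ∎)

    -- Position a goes to c - a. The image face is run backwards, so it is `star (c − a)` that is
    -- odd below 2k, whence c - a is even and below 2k. For a = 1 this bounds c by 2e + 1 from
    -- above, for a = 2e + 1 from below.
    offset-reversing : (σ : GraphAutomorphism Γ) → (∀ d → onDarts σ (turn d) ≡ turn⁻¹ (onDarts σ d)) →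
                       ∀ x → offset σ x ≡ ι (suc (2 * e))
    offset-reversing σ comm x = trans c≡last (cong (λ i → ι (2 * i + suc (2 * e))) (proj₁ (ends {j} {i} i<k same)))
      where
      c = offset σ x
      even : ∀ a → iterate F (mk x (ι a)) (suc e) ≡ mk x (ι a) →
             ∃[ i ] i < suc e × toℕ (c ⊕ neg (ι a)) ≡ 2 * i
      even a closed = subst (λ p → ∃[ i ] i < suc e × toℕ p ≡ 2 * i) (star-involutive (c ⊕ neg (ι a)))
        (star-odd (star (c ⊕ neg (ι a))) (proj₁ odd) (proj₁ (proj₂ odd)) (proj₂ (proj₂ odd)))
        where
        reversed : reverse (onDarts σ (mk x (ι a))) ≡
                   mk (onVertices σ x ⊕ b (c ⊕ neg (ι a))) (star (c ⊕ neg (ι a)))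
        reversed = trans (cong reverse (image-reversing σ comm x a)) (reverse-mk (onVertices σ x) (c ⊕ neg (ι a)))
        odd : ∃[ j ] j < suc e × toℕ (star (c ⊕ neg (ι a))) ≡ suc (2 * j)
        odd = closed⇒odd (onVertices σ x ⊕ b (c ⊕ neg (ι a))) (star (c ⊕ neg (ι a)))
          (subst (λ d → iterate F d (suc e) ≡ d) reversed
            (closed-reversing σ comm (suc e) (mk x (ι a)) closed))
      c≡ : ∀ a i → toℕ (c ⊕ neg (ι a)) ≡ 2 * i → c ≡ ι (2 * i + a)
      c≡ a i eq = begin
        c                           ≡⟨ [x⊕neg-y]⊕y≡x c (ι a) ⟨
        (c ⊕ neg (ι a)) ⊕ ι a       ≡⟨ cong (_⊕ ι a) (toℕ≡⇒≡ι (c ⊕ neg (ι a)) eq) ⟩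
        ι (2 * i) ⊕ ι a             ≡⟨ ι-+ (2 * i) a ⟨
        ι (2 * i + a)               ∎
      first = even 1 (closed-first x)
      last = even (suc (2 * e)) (closed-last x)
      i = proj₁ first
      j = proj₁ last
      i<k = proj₁ (proj₂ first)
      j<k = proj₁ (proj₂ last)
      c≡last : c ≡ ι (2 * j + suc (2 * e))
      c≡last = c≡ (suc (2 * e)) j (proj₂ (proj₂ last))
      same : 2 * j + suc (2 * e) ≡ suc (2 * i)
      same = ι-injective {M} (bound₂ j<k) (bound₁ i<k) (begin
        ι (2 * j + suc (2 * e))     ≡⟨ c≡last ⟨
        c                           ≡⟨ c≡ 1 i (proj₂ (proj₂ first)) ⟩
        ι (2 * i + 1)               ≡⟨ cong ι (+-comm (2 * i) 1) ⟩
        ι (suc (2 * i))             ∎)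

    -- With offset zero, σ commutes with the addition of every neighbour difference. One of these is
    -- 1, which generates ℤ_v.
    preserving⇒translation : (σ : GraphAutomorphism Γ) → (∀ d → onDarts σ (turn d) ≡ turn (onDarts σ d)) →
                             ∃[ g ] ∀ x → onVertices σ x ≡ x ⊕ g
    preserving⇒translation σ comm = s (ι 0) , translates
      where
      s = onVertices σ
      additive : ∀ x p → s (x ⊕ b p) ≡ s x ⊕ b p
      additive x p = cong tgt (begin
        onDarts σ (mk x p)                 ≡⟨ cong (onDarts σ ∘ mk x) (ι-toℕ p) ⟨
        onDarts σ (mk x (ι (toℕ p)))       ≡⟨ image-preserving σ comm x (toℕ p) ⟩
        mk (s x) (offset σ x ⊕ ι (toℕ p))  ≡⟨ cong (λ c → mk (s x) (c ⊕ ι (toℕ p))) (offset-preserving σ comm x) ⟩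
        mk (s x) (ι 0 ⊕ ι (toℕ p))         ≡⟨ cong (mk (s x)) (trans (⊕-identityˡ (ι (toℕ p))) (ι-toℕ p)) ⟩
        mk (s x) p                         ∎)
      step : ∀ x → s (x ⊕ ι 1) ≡ s x ⊕ ι 1
      step x = subst (λ y → s (x ⊕ y) ≡ s x ⊕ y) (b-pos (ι 1) 1∉J) (additive x (pos (ι 1)))
      count : ∀ i → s (ι i) ≡ s (ι 0) ⊕ ι i
      count zero    = sym (⊕-identityʳ (s (ι 0)))
      count (suc i) = begin
        s (ι (suc i))                  ≡⟨ cong s (successor i) ⟩
        s (ι i ⊕ ι 1)                  ≡⟨ step (ι i) ⟩
        s (ι i) ⊕ ι 1                  ≡⟨ cong (_⊕ ι 1) (count i) ⟩
        (s (ι 0) ⊕ ι i) ⊕ ι 1          ≡⟨ ⊕-assoc (s (ι 0)) (ι i) (ι 1) ⟩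
        s (ι 0) ⊕ (ι i ⊕ ι 1)          ≡⟨ cong (s (ι 0) ⊕_) (successor i) ⟨
        s (ι 0) ⊕ ι (suc i)            ∎
        where
        successor : ∀ i → ι {v} (suc i) ≡ ι i ⊕ ι 1
        successor i = trans (cong ι (+-comm 1 i)) (ι-+ i 1)
      translates : ∀ x → s x ≡ x ⊕ s (ι 0)
      translates x = begin
        s x                            ≡⟨ cong s (ι-toℕ x) ⟨
        s (ι (toℕ x))                  ≡⟨ count (toℕ x) ⟩
        s (ι 0) ⊕ ι (toℕ x)            ≡⟨ cong (s (ι 0) ⊕_) (ι-toℕ x) ⟩
        s (ι 0) ⊕ x                    ≡⟨ ⊕-comm (s (ι 0)) x ⟩
        x ⊕ s (ι 0)                    ∎

    -- A reversing σ would satisfy σ (x − h) = σ x − 3h and σ (x − 3h) = σ x − h,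
    -- and then 9h = h.
    ¬reversing : (σ : GraphAutomorphism Γ) → (∀ d → onDarts σ (turn d) ≡ turn⁻¹ (onDarts σ d)) → ⊥
    ¬reversing σ comm = <⇒≢ (*-monoʳ-< 8 0<h) (sym (ι-injective {v} 8h<v (≤-trans (s≤s z≤n) 8h<v) 8h≡0))
      where
      s = onVertices σ
      image : ∀ x a → s (x ⊕ b (ι a)) ≡ s x ⊕ b (ι (suc (2 * e)) ⊕ neg (ι a))
      image x a = cong tgt (trans (image-reversing σ comm x a)
        (cong (λ c → mk (s x) (c ⊕ neg (ι a))) (offset-reversing σ comm x)))
      small : ∀ x → s (x ⊕ neg (ι h)) ≡ s x ⊕ neg (ι (3 * h))
      small x = begin
        s (x ⊕ neg (ι h))                                  ≡⟨ cong (λ y → s (x ⊕ y)) b-first ⟨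
        s (x ⊕ b (ι 0))                                    ≡⟨ image x 0 ⟩
        s x ⊕ b (ι (suc (2 * e)) ⊕ neg (ι 0))              ≡⟨ cong (λ p → s x ⊕ b (p ⊕ neg (ι 0))) (⊕-identityʳ (ι (suc (2 * e)))) ⟨
        s x ⊕ b ((ι (suc (2 * e)) ⊕ ι 0) ⊕ neg (ι 0))      ≡⟨ cong (λ p → s x ⊕ b p) ([x⊕y]⊕neg-y≡x (ι (suc (2 * e))) (ι 0)) ⟩
        s x ⊕ b (ι (suc (2 * e)))                          ≡⟨ cong (s x ⊕_) b-last ⟩
        s x ⊕ neg (ι (3 * h))                              ∎
      large : ∀ x → s (x ⊕ neg (ι (3 * h))) ≡ s x ⊕ neg (ι h)
      large x = begin
        s (x ⊕ neg (ι (3 * h)))                                    ≡⟨ cong (λ y → s (x ⊕ y)) b-last ⟨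
        s (x ⊕ b (ι (suc (2 * e))))                                ≡⟨ image x (suc (2 * e)) ⟩
        s x ⊕ b (ι (suc (2 * e)) ⊕ neg (ι (suc (2 * e))))          ≡⟨ cong (λ p → s x ⊕ b p) (⊕-inverseʳ (ι (suc (2 * e)))) ⟩
        s x ⊕ b (ι 0)                                              ≡⟨ cong (s x ⊕_) b-first ⟩
        s x ⊕ neg (ι h)                                            ∎
      triple : ∀ (x y : Fin v) → ((x ⊕ neg y) ⊕ neg y) ⊕ neg y ≡ x ⊕ neg ((y ⊕ y) ⊕ y)
      triple x y = begin
        ((x ⊕ neg y) ⊕ neg y) ⊕ neg y     ≡⟨ cong (_⊕ neg y) (⊕-assoc x (neg y) (neg y)) ⟩
        (x ⊕ (neg y ⊕ neg y)) ⊕ neg y     ≡⟨ ⊕-assoc x (neg y ⊕ neg y) (neg y) ⟩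
        x ⊕ ((neg y ⊕ neg y) ⊕ neg y)     ≡⟨ cong (λ z → x ⊕ (z ⊕ neg y)) (neg-⊕ y y) ⟨
        x ⊕ (neg (y ⊕ y) ⊕ neg y)         ≡⟨ cong (x ⊕_) (neg-⊕ (y ⊕ y) y) ⟨
        x ⊕ neg ((y ⊕ y) ⊕ y)             ∎
      ι-triple : ∀ a → (ι {v} a ⊕ ι a) ⊕ ι a ≡ ι (3 * a)
      ι-triple a = begin
        (ι a ⊕ ι a) ⊕ ι a     ≡⟨ cong (_⊕ ι a) (ι-+ a a) ⟨
        ι (a + a) ⊕ ι a       ≡⟨ ι-+ (a + a) a ⟨
        ι (a + a + a)         ≡⟨ cong ι (thrice a) ⟩
        ι (3 * a)             ∎
        where
        thrice : ∀ a → a + a + a ≡ 3 * a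
        thrice = solve-∀
      x : Fin v
      x = ι 0
      both : s x ⊕ neg (ι h) ≡ s x ⊕ neg (ι (3 * (3 * h)))
      both = begin
        s x ⊕ neg (ι h)                                              ≡⟨ large x ⟨
        s (x ⊕ neg (ι (3 * h)))                                      ≡⟨ cong (λ z → s (x ⊕ neg z)) (ι-triple h) ⟨
        s (x ⊕ neg ((ι h ⊕ ι h) ⊕ ι h))                              ≡⟨ cong s (triple x (ι h)) ⟨
        s (((x ⊕ neg (ι h)) ⊕ neg (ι h)) ⊕ neg (ι h))                ≡⟨ small ((x ⊕ neg (ι h)) ⊕ neg (ι h)) ⟩
        s ((x ⊕ neg (ι h)) ⊕ neg (ι h)) ⊕ neg (ι (3 * h))            ≡⟨ cong (_⊕ neg (ι (3 * h))) (small (x ⊕ neg (ι h))) ⟩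
        (s (x ⊕ neg (ι h)) ⊕ neg (ι (3 * h))) ⊕ neg (ι (3 * h))      ≡⟨ cong (λ z → (z ⊕ neg (ι (3 * h))) ⊕ neg (ι (3 * h))) (small x) ⟩
        ((s x ⊕ neg (ι (3 * h))) ⊕ neg (ι (3 * h))) ⊕ neg (ι (3 * h)) ≡⟨ triple (s x) (ι (3 * h)) ⟩
        s x ⊕ neg ((ι (3 * h) ⊕ ι (3 * h)) ⊕ ι (3 * h))              ≡⟨ cong (λ z → s x ⊕ neg z) (ι-triple (3 * h)) ⟩
        s x ⊕ neg (ι (3 * (3 * h)))                                  ∎
      8h≡0 : ι {v} (8 * h) ≡ ι 0
      8h≡0 = ⊕-cancelʳ (ι h) (ι (8 * h)) (ι 0) (begin
        ι (8 * h) ⊕ ι h                ≡⟨ ι-+ (8 * h) h ⟨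
        ι (8 * h + h)                  ≡⟨ cong ι (nine h) ⟩
        ι (3 * (3 * h))                ≡⟨ neg-involutive (ι (3 * (3 * h))) ⟨
        neg (neg (ι (3 * (3 * h))))    ≡⟨ cong neg (⊕-cancelˡ (s x) (neg (ι h)) (neg (ι (3 * (3 * h)))) both) ⟨
        neg (neg (ι h))                ≡⟨ neg-involutive (ι h) ⟩
        ι h                            ≡⟨ ⊕-identityˡ (ι h) ⟨
        ι 0 ⊕ ι h                      ∎)
        where
        nine : ∀ h → 8 * h + h ≡ 3 * (3 * h)
        nine = solve-∀

    autIsℤᵥ : AutIsℤᵥ Π
    autIsℤᵥ = (λ g → (translation g , translation-isAutomorphism g) , λ _ → refl) , onlyTranslations
      where
      onlyTranslations : ((σ , _) : Aut Π) → ∃[ g ] ∀ x → onVertices σ x ≡ x ⊕ g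
      onlyTranslations (σ , inj₁ comm) = preserving⇒translation σ comm
      onlyTranslations (σ , inj₂ comm) = contradiction comm (¬reversing σ)

-- The pairing of positions

even⊎odd : ∀ s → ∃[ i ] (s ≡ i * 2 ⊎ s ≡ suc (i * 2))
even⊎odd zero          = 0 , inj₁ refl
even⊎odd (suc zero)    = 0 , inj₂ refl
even⊎odd (suc (suc s)) with even⊎odd s
... | i , inj₁ s≡ = suc i , inj₁ (cong (λ r → suc (suc r)) s≡)
... | i , inj₂ s≡ = suc i , inj₂ (cong (λ r → suc (suc r)) s≡)

Sign : Set
Sign = Bool

flip : ∀ {I : Set} → I × Sign → I × Sign
flip = map₂ not

flip-involutive : ∀ {I : Set} (i : I × Sign) → flip (flip i) ≡ i
flip-involutive (i , β) = cong (i ,_) (not-involutive β)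

-- After k face steps an odd position in block a lies in block α⁻¹ a, and an even
-- one in block α a + 1; hence only the odd positions of block 0 return.

record Twist (n : ℕ) .{{_ : NonZero n}} : Set where
  field
    α α⁻¹   : Fin n → Fin n
    α-α⁻¹   : ∀ a → α (α⁻¹ a) ≡ a
    α⁻¹-α   : ∀ a → α⁻¹ (α a) ≡ a
    α-0     : α (ι 0) ≡ ι 0
    α-fixed : ∀ a → α a ≡ a → a ≡ ι 0
    α-shift : ∀ a → α a ⊕ ι 1 ≢ a

-- The map fixes 0 and permutes the other n blocks cyclically. In ℤ_(n+1) the equation α a + 1 = a
-- becomes a + 2 = a for 0 < a < n, and 2 = n for the last block a = n, where the cycle jumps back
-- to 1; hence the condition 2 < n.
twist : ∀ n → 2 < n → Twist (suc n)
twist n@(suc _) 2<n = record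
  { α = α ; α⁻¹ = α⁻¹ ; α-α⁻¹ = α-α⁻¹ ; α⁻¹-α = α⁻¹-α ; α-0 = refl ; α-fixed = α-fixed ; α-shift = α-shift }
  where
  α α⁻¹ : Fin (suc n) → Fin (suc n)
  α zero      = zero
  α (suc x)   = suc (x ⊕ ι 1)
  α⁻¹ zero    = zero
  α⁻¹ (suc x) = suc (x ⊕ neg (ι 1))
  α-α⁻¹ : ∀ a → α (α⁻¹ a) ≡ a
  α-α⁻¹ zero    = refl
  α-α⁻¹ (suc x) = cong suc ([x⊕neg-y]⊕y≡x x (ι 1))
  α⁻¹-α : ∀ a → α⁻¹ (α a) ≡ a
  α⁻¹-α zero    = refl
  α⁻¹-α (suc x) = cong suc ([x⊕y]⊕neg-y≡x x (ι 1))
  1<n : 1 < n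
  1<n = <-trans (s≤s (s≤s z≤n)) 2<n
  α-fixed : ∀ a → α a ≡ a → a ≡ zero
  α-fixed zero    _  = refl
  α-fixed (suc x) eq = contradiction (∣⇒≤ n∣1) (<⇒≱ 1<n)
    where
    n∣1 : n ∣ 1
    n∣1 = [m+n]%d≡m%d⇒d∣n (toℕ x) 1 n (begin
      (toℕ x + 1) % n        ≡⟨ %-⊕ ∣-refl x 1 ⟨
      toℕ (x ⊕ ι 1) % n      ≡⟨ cong (λ y → toℕ y % n) (Fin-suc-injective eq) ⟩
      toℕ x % n              ∎)
  α-shift : ∀ a → α a ⊕ ι 1 ≢ a
  α-shift zero    ()
  α-shift (suc x) eq with suc (toℕ x) <? n
  ... | yes 1+x<n = contradiction (∣⇒≤ 1+n∣2) (<⇒≱ (m≤n⇒m≤1+n 2<n))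
    where
    1+n∣2 : suc n ∣ 2
    1+n∣2 = [m+n]%d≡m%d⇒d∣n (toℕ (suc x)) 2 (suc n) (begin
      (suc (toℕ x) + 2) % suc n                  ≡⟨ cong (_% suc n) (+-assoc (suc (toℕ x)) 1 1) ⟨
      (suc (toℕ x + 1) + 1) % suc n              ≡⟨ cong (λ r → (suc r + 1) % suc n) (m<n⇒m%n≡m {n = n} (subst (_< n) (+-comm 1 (toℕ x)) 1+x<n)) ⟨
      (suc ((toℕ x + 1) % n) + 1) % suc n        ≡⟨ cong (λ r → (suc r + 1) % suc n) (begin
          toℕ (x ⊕ ι 1)           ≡⟨ m<n⇒m%n≡m (toℕ<n (x ⊕ ι 1)) ⟨
          toℕ (x ⊕ ι 1) % n       ≡⟨ %-⊕ ∣-refl x 1 ⟩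
          (toℕ x + 1) % n         ∎) ⟨
      (toℕ (α (suc x)) + 1) % suc n              ≡⟨ %-⊕ ∣-refl (α (suc x)) 1 ⟨
      toℕ (α (suc x) ⊕ ι 1) % suc n              ≡⟨ cong (λ y → toℕ y % suc n) eq ⟩
      toℕ (suc x) % suc n                        ∎)
  ... | no  1+x≮n = contradiction (begin
      2                                  ≡⟨ m<n⇒m%n≡m {n = suc n} (m≤n⇒m≤1+n 2<n) ⟨
      2 % suc n                          ≡⟨ cong (λ r → (suc r + 1) % suc n) x⊕1≡0 ⟨
      (toℕ (α (suc x)) + 1) % suc n      ≡⟨ %-⊕ ∣-refl (α (suc x)) 1 ⟨
      toℕ (α (suc x) ⊕ ι 1) % suc n      ≡⟨ cong (λ y → toℕ y % suc n) eq ⟩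
      toℕ (suc x) % suc n                ≡⟨ m<n⇒m%n≡m (toℕ<n (suc x)) ⟩
      suc (toℕ x)                        ≡⟨ 1+x≡n ⟩
      n                                  ∎) (<⇒≢ 2<n)
    where
    1+x≡n : suc (toℕ x) ≡ n
    1+x≡n = ≤-antisym (toℕ<n x) (≮⇒≥ 1+x≮n)
    x⊕1≡0 : toℕ (x ⊕ ι 1) ≡ 0
    x⊕1≡0 = begin
      toℕ (x ⊕ ι 1)           ≡⟨ m<n⇒m%n≡m (toℕ<n (x ⊕ ι 1)) ⟨
      toℕ (x ⊕ ι 1) % n       ≡⟨ %-⊕ ∣-refl x 1 ⟩
      (toℕ x + 1) % n         ≡⟨ cong (_% n) (trans (+-comm (toℕ x) 1) 1+x≡n) ⟩
      n % n                   ≡⟨ n%n≡0 n ⟩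
      0                       ∎

-- A position 2 k a + s is written lo a s if s < k, and hi a (s − k) otherwise.

module Positions {n : ℕ} .{{_ : NonZero n}} (τ : Twist n) (k h : ℕ) (k≡ : k ≡ suc (h * 2))
                 .{{_ : NonZero (2 * k)}} .{{_ : NonZero (n * (2 * k))}} where

  open Twist τ

  M : ℕ
  M = n * (2 * k)

  lo hi : Fin n → ℕ → Fin M
  lo a s = ι (2 * k * toℕ a + s)
  hi a s = ι (2 * k * toℕ a + (k + s))

  -- The digit form of a position, suited to bijections and case distinctions; `lo` and `hi` are the
  -- arithmetic form, suited to adding 1 with a carry.
  side : Fin n → Fin 2 → Fin k → Fin M
  side a e s = combine a (combine e s)

  toℕ-side : ∀ a e s → toℕ (side a e s) ≡ 2 * k * toℕ a + (k * toℕ e + toℕ s)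
  toℕ-side a e s = trans (toℕ-combine a (combine e s)) (cong (2 * k * toℕ a +_) (toℕ-combine e s))

  side≡lo : ∀ a s → side a zero s ≡ lo a (toℕ s)
  side≡lo a s = trans (sym (ι-toℕ (side a zero s)))
    (cong ι (trans (toℕ-side a zero s) (cong (λ r → 2 * k * toℕ a + (r + toℕ s)) (*-zeroʳ k))))

  side≡hi : ∀ a s → side a (suc zero) s ≡ hi a (toℕ s)
  side≡hi a s = trans (sym (ι-toℕ (side a (suc zero) s)))
    (cong ι (trans (toℕ-side a (suc zero) s) (cong (λ r → 2 * k * toℕ a + (r + toℕ s)) (*-identityʳ k))))

  lo≡side : ∀ a {s} (s<k : s < k) → lo a s ≡ side a zero (fromℕ< s<k)
  lo≡side a s<k = sym (trans (side≡lo a (fromℕ< s<k)) (cong (lo a) (toℕ-fromℕ< s<k)))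

  hi≡side : ∀ a {s} (s<k : s < k) → hi a s ≡ side a (suc zero) (fromℕ< s<k)
  hi≡side a s<k = sym (trans (side≡hi a (fromℕ< s<k)) (cong (hi a) (toℕ-fromℕ< s<k)))

  toℕ-lo : ∀ a {s} → s < k → toℕ (lo a s) ≡ 2 * k * toℕ a + s
  toℕ-lo a s<k = begin
    toℕ (lo a _)                                        ≡⟨ cong toℕ (lo≡side a s<k) ⟩
    toℕ (side a zero (fromℕ< s<k))                      ≡⟨ toℕ-side a zero (fromℕ< s<k) ⟩
    2 * k * toℕ a + (k * 0 + toℕ (fromℕ< s<k))          ≡⟨ cong₂ (λ r s → 2 * k * toℕ a + (r + s)) (*-zeroʳ k) (toℕ-fromℕ< s<k) ⟩
    2 * k * toℕ a + _                                   ∎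

  toℕ-hi : ∀ a {s} → s < k → toℕ (hi a s) ≡ 2 * k * toℕ a + (k + s)
  toℕ-hi a s<k = begin
    toℕ (hi a _)                                        ≡⟨ cong toℕ (hi≡side a s<k) ⟩
    toℕ (side a (suc zero) (fromℕ< s<k))                ≡⟨ toℕ-side a (suc zero) (fromℕ< s<k) ⟩
    2 * k * toℕ a + (k * 1 + toℕ (fromℕ< s<k))          ≡⟨ cong₂ (λ r s → 2 * k * toℕ a + (r + s)) (*-identityʳ k) (toℕ-fromℕ< s<k) ⟩
    2 * k * toℕ a + (k + _)                             ∎

  Index : Set
  Index = Fin n × Fin k

  -- The positions `lo a s` and `hi (α a) s` form a pair, and the pair takes its index from the
  -- former; hence α⁻¹ in the second clause.
  at′ : Fin n → Fin 2 → Fin k → Index × Sign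
  at′ a zero       s = (a , s) , false
  at′ a (suc zero) s = (α⁻¹ a , s) , true

  pair : Fin M → Index × Sign
  pair p = at′ (proj₁ (remQuot (2 * k) p)) (proj₁ (remQuot k (proj₂ (remQuot {n} (2 * k) p))))
               (proj₂ (remQuot {2} k (proj₂ (remQuot {n} (2 * k) p))))

  unpair : Index × Sign → Fin M
  unpair ((a , s) , false) = side a zero s
  unpair ((a , s) , true)  = side (α a) (suc zero) s

  pair-side : ∀ a e s → pair (side a e s) ≡ at′ a e s
  pair-side a e s = begin
    pair (side a e s)
      ≡⟨ cong (λ r → at′ (proj₁ r) (proj₁ (remQuot k (proj₂ r))) (proj₂ (remQuot {2} k (proj₂ r)))) (remQuot-combine a (combine e s)) ⟩
    at′ a (proj₁ (remQuot k (combine e s))) (proj₂ (remQuot {2} k (combine e s)))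
      ≡⟨ cong (λ r → at′ a (proj₁ r) (proj₂ r)) (remQuot-combine e s) ⟩
    at′ a e s ∎

  side-surjective : ∀ p → ∃[ a ] ∃[ e ] ∃[ s ] p ≡ side a e s
  side-surjective p = a , proj₁ (remQuot k r) , proj₂ (remQuot {2} k r) , (begin
    p                                                        ≡⟨ combine-remQuot {n} (2 * k) p ⟨
    combine a r                                              ≡⟨ cong (combine a) (combine-remQuot {2} k r) ⟨
    side a (proj₁ (remQuot k r)) (proj₂ (remQuot {2} k r))   ∎)
    where
    a = proj₁ (remQuot {n} (2 * k) p)
    r = proj₂ (remQuot {n} (2 * k) p)

  pair-unpair : ∀ i → pair (unpair i) ≡ i
  pair-unpair ((a , s) , false) = pair-side a zero s
  pair-unpair ((a , s) , true)  = trans (pair-side (α a) (suc zero) s) (cong (λ c → (c , s) , true) (α⁻¹-α a))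

  unpair-at′ : ∀ a e s → unpair (at′ a e s) ≡ side a e s
  unpair-at′ a zero       s = refl
  unpair-at′ a (suc zero) s = cong (λ c → side c (suc zero) s) (α-α⁻¹ a)

  unpair-pair : ∀ p → unpair (pair p) ≡ p
  unpair-pair p = begin
    unpair (pair p)                ≡⟨ cong (unpair ∘ pair) p≡ ⟩
    unpair (pair (side a e s))     ≡⟨ cong unpair (pair-side a e s) ⟩
    unpair (at′ a e s)             ≡⟨ unpair-at′ a e s ⟩
    side a e s                     ≡⟨ p≡ ⟨
    p                              ∎
    where
    a = proj₁ (side-surjective p)
    e = proj₁ (proj₂ (side-surjective p))
    s = proj₁ (proj₂ (proj₂ (side-surjective p)))
    p≡ = proj₂ (proj₂ (proj₂ (side-surjective p)))

  mate : Fin M → Fin M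
  mate p = unpair (flip (pair p))

  step : Fin M → Fin M
  step p = mate p ⊕ ι 1

  mate-side-lo : ∀ a s → mate (side a zero s) ≡ side (α a) (suc zero) s
  mate-side-lo a s = cong (unpair ∘ flip) (pair-side a zero s)

  mate-side-hi : ∀ a s → mate (side a (suc zero) s) ≡ side (α⁻¹ a) zero s
  mate-side-hi a s = cong (unpair ∘ flip) (pair-side a (suc zero) s)

  mate-lo : ∀ a {s} → s < k → mate (lo a s) ≡ hi (α a) s
  mate-lo a s<k = begin
    mate (lo a _)                                ≡⟨ cong mate (lo≡side a s<k) ⟩
    mate (side a zero (fromℕ< s<k))              ≡⟨ mate-side-lo a (fromℕ< s<k) ⟩
    side (α a) (suc zero) (fromℕ< s<k)           ≡⟨ hi≡side (α a) s<k ⟨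
    hi (α a) _                                   ∎

  mate-hi : ∀ a {s} → s < k → mate (hi a s) ≡ lo (α⁻¹ a) s
  mate-hi a s<k = begin
    mate (hi a _)                                ≡⟨ cong mate (hi≡side a s<k) ⟩
    mate (side a (suc zero) (fromℕ< s<k))        ≡⟨ mate-side-hi a (fromℕ< s<k) ⟩
    side (α⁻¹ a) zero (fromℕ< s<k)               ≡⟨ lo≡side (α⁻¹ a) s<k ⟨
    lo (α⁻¹ a) _                                 ∎

  lo⊎hi : ∀ p → ∃[ a ] ∃[ s ] s < k × (p ≡ lo a s ⊎ p ≡ hi a s)
  lo⊎hi p = split (side-surjective p)
    where
    split : ∃[ a ] ∃[ e ] ∃[ s ] p ≡ side a e s → ∃[ a ] ∃[ s ] s < k × (p ≡ lo a s ⊎ p ≡ hi a s)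
    split (a , zero     , s , p≡) = a , toℕ s , toℕ<n s , inj₁ (trans p≡ (side≡lo a s))
    split (a , suc zero , s , p≡) = a , toℕ s , toℕ<n s , inj₂ (trans p≡ (side≡hi a s))

  -- Passing to the mate moves between blocks, which costs a multiple of 2k, and changes the half,
  -- which adds or subtracts k; modulo 2k both are the same.
  mate-mod : ∀ p → toℕ (mate p) % (2 * k) ≡ (toℕ p + k) % (2 * k)
  mate-mod p = by (lo⊎hi p)
    where
    reduce : ∀ c r → (2 * k * c + r) % (2 * k) ≡ r % (2 * k)
    reduce c r = begin
      (2 * k * c + r) % (2 * k)     ≡⟨ cong (_% (2 * k)) (trans (+-comm (2 * k * c) r) (cong (r +_) (*-comm (2 * k) c))) ⟩
      (r + c * (2 * k)) % (2 * k)   ≡⟨ [m+kn]%n≡m%n r c (2 * k) ⟩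
      r % (2 * k)                   ∎
    by : ∃[ a ] ∃[ s ] s < k × (p ≡ lo a s ⊎ p ≡ hi a s) → toℕ (mate p) % (2 * k) ≡ (toℕ p + k) % (2 * k)
    by (a , s , s<k , inj₁ p≡) = begin
      toℕ (mate p) % (2 * k)                       ≡⟨ cong (λ p → toℕ p % (2 * k)) (trans (cong mate p≡) (mate-lo a s<k)) ⟩
      toℕ (hi (α a) s) % (2 * k)                   ≡⟨ cong (_% (2 * k)) (toℕ-hi (α a) s<k) ⟩
      (2 * k * toℕ (α a) + (k + s)) % (2 * k)      ≡⟨ reduce (toℕ (α a)) (k + s) ⟩
      (k + s) % (2 * k)                            ≡⟨ cong (_% (2 * k)) (+-comm k s) ⟩
      (s + k) % (2 * k)                            ≡⟨ reduce (toℕ a) (s + k) ⟨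
      (2 * k * toℕ a + (s + k)) % (2 * k)          ≡⟨ cong (_% (2 * k)) (+-assoc (2 * k * toℕ a) s k) ⟨
      (2 * k * toℕ a + s + k) % (2 * k)            ≡⟨ cong (λ r → (r + k) % (2 * k)) (toℕ-lo a s<k) ⟨
      (toℕ (lo a s) + k) % (2 * k)                 ≡⟨ cong (λ p → (toℕ p + k) % (2 * k)) p≡ ⟨
      (toℕ p + k) % (2 * k)                        ∎
    by (a , s , s<k , inj₂ p≡) = begin
      toℕ (mate p) % (2 * k)                       ≡⟨ cong (λ p → toℕ p % (2 * k)) (trans (cong mate p≡) (mate-hi a s<k)) ⟩
      toℕ (lo (α⁻¹ a) s) % (2 * k)                 ≡⟨ cong (_% (2 * k)) (toℕ-lo (α⁻¹ a) s<k) ⟩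
      (2 * k * toℕ (α⁻¹ a) + s) % (2 * k)          ≡⟨ reduce (toℕ (α⁻¹ a)) s ⟩
      s % (2 * k)                                  ≡⟨ [m+kn]%n≡m%n s 1 (2 * k) ⟨
      (s + 1 * (2 * k)) % (2 * k)                  ≡⟨ cong (_% (2 * k)) (rearrange k s) ⟩
      (k + s + k) % (2 * k)                        ≡⟨ reduce (toℕ a) (k + s + k) ⟨
      (2 * k * toℕ a + (k + s + k)) % (2 * k)      ≡⟨ cong (_% (2 * k)) (+-assoc (2 * k * toℕ a) (k + s) k) ⟨
      (2 * k * toℕ a + (k + s) + k) % (2 * k)      ≡⟨ cong (λ r → (r + k) % (2 * k)) (toℕ-hi a s<k) ⟨
      (toℕ (hi a s) + k) % (2 * k)                 ≡⟨ cong (λ p → (toℕ p + k) % (2 * k)) p≡ ⟨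
      (toℕ p + k) % (2 * k)                        ∎
      where
      rearrange : ∀ k s → s + 1 * (2 * k) ≡ k + s + k
      rearrange = solve-∀

  -- The carries at the end of a walk: `lo` and `hi` accept any natural number, so s = k is a
  -- legitimate name for the beginning of the next half.
  lo-k : ∀ a → lo a k ≡ hi a 0
  lo-k a = cong (λ r → ι (2 * k * toℕ a + r)) (sym (+-identityʳ k))

  hi-k : ∀ a → hi a k ≡ lo (a ⊕ ι 1) 0
  hi-k a = begin
    ι (2 * k * toℕ a + (k + k))            ≡⟨ cong ι (rearrange k (toℕ a)) ⟩
    ι ((toℕ a + 1) * (2 * k))              ≡⟨ ι-cong {M} (m%n%n≡m%n ((toℕ a + 1) * (2 * k)) M) ⟨
    ι ((toℕ a + 1) * (2 * k) % M)          ≡⟨ cong ι (m%n*o≡m*o%[n*o] (toℕ a + 1) n (2 * k)) ⟨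
    ι ((toℕ a + 1) % n * (2 * k))          ≡⟨ cong (λ r → ι (r * (2 * k))) (%-⊕ ∣-refl a 1) ⟨
    ι (toℕ (a ⊕ ι 1) % n * (2 * k))        ≡⟨ cong (λ r → ι (r * (2 * k))) (m<n⇒m%n≡m (toℕ<n (a ⊕ ι 1))) ⟩
    ι (toℕ (a ⊕ ι 1) * (2 * k))            ≡⟨ cong ι (trans (*-comm (toℕ (a ⊕ ι 1)) (2 * k)) (sym (+-identityʳ _))) ⟩
    lo (a ⊕ ι 1) 0                         ∎
    where
    rearrange : ∀ k c → 2 * k * c + (k + k) ≡ (c + 1) * (2 * k)
    rearrange = solve-∀

  ι-suc : ∀ c → ι {M} c ⊕ ι 1 ≡ ι (suc c)
  ι-suc c = trans (sym (ι-+ c 1)) (cong ι (+-comm c 1))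

  step-lo : ∀ a {s} → s < k → step (lo a s) ≡ hi (α a) (suc s)
  step-lo a {s} s<k = begin
    mate (lo a s) ⊕ ι 1                          ≡⟨ cong (_⊕ ι 1) (mate-lo a s<k) ⟩
    hi (α a) s ⊕ ι 1                             ≡⟨ ι-suc (2 * k * toℕ (α a) + (k + s)) ⟩
    ι (suc (2 * k * toℕ (α a) + (k + s)))        ≡⟨ cong ι (rearrange (2 * k * toℕ (α a)) k s) ⟩
    hi (α a) (suc s)                             ∎
    where
    rearrange : ∀ c k s → suc (c + (k + s)) ≡ c + (k + suc s)
    rearrange = solve-∀

  step-hi : ∀ a {s} → s < k → step (hi a s) ≡ lo (α⁻¹ a) (suc s)
  step-hi a {s} s<k = begin
    mate (hi a s) ⊕ ι 1                          ≡⟨ cong (_⊕ ι 1) (mate-hi a s<k) ⟩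
    lo (α⁻¹ a) s ⊕ ι 1                           ≡⟨ ι-suc (2 * k * toℕ (α⁻¹ a) + s) ⟩
    ι (suc (2 * k * toℕ (α⁻¹ a) + s))            ≡⟨ cong ι (sym (+-suc (2 * k * toℕ (α⁻¹ a)) s)) ⟩
    lo (α⁻¹ a) (suc s)                           ∎

  lo-injective : ∀ {a c} → lo a 0 ≡ lo c 0 → a ≡ c
  lo-injective {a} {c} eq = toℕ-injective (*-cancelˡ-≡ (toℕ a) (toℕ c) (2 * k) (+-cancelʳ-≡ 0 _ _ (begin
    2 * k * toℕ a + 0     ≡⟨ toℕ-lo a 0<k ⟨
    toℕ (lo a 0)          ≡⟨ cong toℕ eq ⟩
    toℕ (lo c 0)          ≡⟨ toℕ-lo c 0<k ⟩
    2 * k * toℕ c + 0     ∎)))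
    where
    0<k : 0 < k
    0<k = subst (0 <_) (sym k≡) z<s

  hi-injective : ∀ {a c} → hi a 0 ≡ hi c 0 → a ≡ c
  hi-injective {a} {c} eq = toℕ-injective (*-cancelˡ-≡ (toℕ a) (toℕ c) (2 * k) (+-cancelʳ-≡ (k + 0) _ _ (begin
    2 * k * toℕ a + (k + 0)     ≡⟨ toℕ-hi a 0<k ⟨
    toℕ (hi a 0)                ≡⟨ cong toℕ eq ⟩
    toℕ (hi c 0)                ≡⟨ toℕ-hi c 0<k ⟩
    2 * k * toℕ c + (k + 0)     ∎)))
    where
    0<k : 0 < k
    0<k = subst (0 <_) (sym k≡) z<s

  mate-involutive : ∀ p → mate (mate p) ≡ p
  mate-involutive p = begin
    unpair (flip (pair (unpair (flip (pair p)))))     ≡⟨ cong (unpair ∘ flip) (pair-unpair (flip (pair p))) ⟩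
    unpair (flip (flip (pair p)))                     ≡⟨ cong unpair (flip-involutive (pair p)) ⟩
    unpair (pair p)                                   ≡⟨ unpair-pair p ⟩
    p                                                 ∎

  step-injective : ∀ {p q} → step p ≡ step q → p ≡ q
  step-injective {p} {q} eq = begin
    p               ≡⟨ mate-involutive p ⟨
    mate (mate p)   ≡⟨ cong mate (⊕-cancelʳ (ι 1) (mate p) (mate q) eq) ⟩
    mate (mate q)   ≡⟨ mate-involutive q ⟩
    q               ∎

  -- Two consecutive steps apply α⁻¹ and α, which cancel, so the block is kept while s grows by two.
  walk-hi : ∀ a s i → s + i * 2 < k → iterate step (hi a s) (i * 2) ≡ hi a (s + i * 2)
  walk-hi a s zero    _   = cong (hi a) (sym (+-identityʳ s))
  walk-hi a s (suc i) lt  = begin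
    iterate step (step (step (hi a s))) (i * 2)      ≡⟨ cong (λ p → iterate step p (i * 2)) (begin
      step (step (hi a s))           ≡⟨ cong step (step-hi a (<-trans (n<1+n s) 1+s<k)) ⟩
      step (lo (α⁻¹ a) (suc s))      ≡⟨ step-lo (α⁻¹ a) 1+s<k ⟩
      hi (α (α⁻¹ a)) (2 + s)         ≡⟨ cong (λ c → hi c (2 + s)) (α-α⁻¹ a) ⟩
      hi a (2 + s)                   ∎) ⟩
    iterate step (hi a (2 + s)) (i * 2)              ≡⟨ walk-hi a (2 + s) i (subst (_< k) shift lt) ⟩
    hi a (2 + s + i * 2)                             ≡⟨ cong (hi a) shift ⟨
    hi a (s + suc i * 2)                             ∎
    where
    shift : s + suc i * 2 ≡ 2 + s + i * 2
    shift = rearrange s i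
      where
      rearrange : ∀ s i → s + (2 + i * 2) ≡ 2 + s + i * 2
      rearrange = solve-∀
    1+s<k : suc s < k
    1+s<k = ≤-trans (s≤s (s≤s (≤-trans (m≤m+n s (i * 2)) (n≤1+n _)))) (subst (_< k) shift lt)

  walk-lo : ∀ a s i → s + i * 2 < k → iterate step (lo a s) (i * 2) ≡ lo a (s + i * 2)
  walk-lo a s zero    _   = cong (lo a) (sym (+-identityʳ s))
  walk-lo a s (suc i) lt  = begin
    iterate step (step (step (lo a s))) (i * 2)      ≡⟨ cong (λ p → iterate step p (i * 2)) (begin
      step (step (lo a s))           ≡⟨ cong step (step-lo a (<-trans (n<1+n s) 1+s<k)) ⟩
      step (hi (α a) (suc s))        ≡⟨ step-hi (α a) 1+s<k ⟩
      lo (α⁻¹ (α a)) (2 + s)         ≡⟨ cong (λ c → lo c (2 + s)) (α⁻¹-α a) ⟩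
      lo a (2 + s)                   ∎) ⟩
    iterate step (lo a (2 + s)) (i * 2)              ≡⟨ walk-lo a (2 + s) i (subst (_< k) shift lt) ⟩
    lo a (2 + s + i * 2)                             ≡⟨ cong (lo a) shift ⟨
    lo a (s + suc i * 2)                             ∎
    where
    shift : s + suc i * 2 ≡ 2 + s + i * 2
    shift = rearrange s i
      where
      rearrange : ∀ s i → s + (2 + i * 2) ≡ 2 + s + i * 2
      rearrange = solve-∀
    1+s<k : suc s < k
    1+s<k = ≤-trans (s≤s (s≤s (≤-trans (m≤m+n s (i * 2)) (n≤1+n _)))) (subst (_< k) shift lt)

  2h<k : h * 2 < k
  2h<k = ≤-reflexive (sym k≡)

  k≡2h+1 : k ≡ h * 2 + 1
  k≡2h+1 = trans k≡ (+-comm 1 (h * 2))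

  iterate-k : ∀ {A : Set} (f : A → A) x → iterate f x k ≡ f (iterate f x (h * 2))
  iterate-k f x = trans (cong (iterate f x) k≡2h+1) (iterate-+ f x (h * 2) 1)

  -- Because k is odd, one step remains after the cancelling pairs; it applies α⁻¹ once and carries
  -- into the high half.
  return-hi : ∀ a → iterate step (hi a 0) k ≡ hi (α⁻¹ a) 0
  return-hi a = begin
    iterate step (hi a 0) k              ≡⟨ iterate-k step (hi a 0) ⟩
    step (iterate step (hi a 0) (h * 2)) ≡⟨ cong step (walk-hi a 0 h 2h<k) ⟩
    step (hi a (h * 2))                  ≡⟨ step-hi a 2h<k ⟩
    lo (α⁻¹ a) (suc (h * 2))             ≡⟨ cong (lo (α⁻¹ a)) k≡ ⟨
    lo (α⁻¹ a) k                         ≡⟨ lo-k (α⁻¹ a) ⟩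
    hi (α⁻¹ a) 0                         ∎

  return-lo : ∀ a → iterate step (lo a 0) k ≡ lo (α a ⊕ ι 1) 0
  return-lo a = begin
    iterate step (lo a 0) k              ≡⟨ iterate-k step (lo a 0) ⟩
    step (iterate step (lo a 0) (h * 2)) ≡⟨ cong step (walk-lo a 0 h 2h<k) ⟩
    step (lo a (h * 2))                  ≡⟨ step-lo a 2h<k ⟩
    hi (α a) (suc (h * 2))               ≡⟨ cong (hi (α a)) k≡ ⟨
    hi (α a) k                           ≡⟨ hi-k (α a) ⟩
    lo (α a ⊕ ι 1) 0                     ∎

  toℕ-lo₀ : ∀ {s} → s < k → toℕ (lo (ι 0) s) ≡ s
  toℕ-lo₀ {s} s<k = trans (toℕ-lo (ι 0) s<k) (cong (_+ s) (trans (cong (2 * k *_) (toℕ-ι-< (>-nonZero⁻¹ n))) (*-zeroʳ (2 * k))))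

  toℕ-hi₀ : ∀ {s} → s < k → toℕ (hi (ι 0) s) ≡ k + s
  toℕ-hi₀ {s} s<k = trans (toℕ-hi (ι 0) s<k) (cong (_+ (k + s)) (trans (cong (2 * k *_) (toℕ-ι-< (>-nonZero⁻¹ n))) (*-zeroʳ (2 * k))))

  -- Injectivity of `step` carries k-periodicity back along an orbit. Every position is reached in
  -- fewer than k steps from some `hi c 0` or `lo c 0`, in the same half if s is even and in the
  -- other half if s is odd; there `return-hi` and `return-lo` decide.
  periodic⇒odd : ∀ p → iterate step p k ≡ p → ∃[ j ] j < k × toℕ p ≡ suc (2 * j)
  periodic⇒odd p periodic = by (lo⊎hi p)
    where
    unwind : ∀ z j → iterate step z j ≡ p → iterate step z k ≡ z
    unwind z j z→p = iterate-injective step-injective j (begin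
      iterate step (iterate step z k) j      ≡⟨ iterate-+ step z k j ⟨
      iterate step z (k + j)                 ≡⟨ cong (iterate step z) (+-comm k j) ⟩
      iterate step z (j + k)                 ≡⟨ iterate-+ step z j k ⟩
      iterate step (iterate step z j) k      ≡⟨ cong (λ q → iterate step q k) z→p ⟩
      iterate step p k                       ≡⟨ periodic ⟩
      p                                      ≡⟨ z→p ⟨
      iterate step z j                       ∎)
    fixed-hi : ∀ a j → iterate step (hi a 0) j ≡ p → a ≡ ι 0
    fixed-hi a j z→p = α-fixed a (trans (cong α (sym (hi-injective (trans (sym (return-hi a)) (unwind (hi a 0) j z→p))))) (α-α⁻¹ a))
    absurd-lo : ∀ {A : Set} a j → iterate step (lo a 0) j ≡ p → A
    absurd-lo a j z→p = contradiction (lo-injective (trans (sym (return-lo a)) (unwind (lo a 0) j z→p))) (α-shift a)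
    from-hi : ∀ a i → suc (i * 2) < k → iterate step (hi a 0) (suc (i * 2)) ≡ lo (α⁻¹ a) (suc (i * 2))
    from-hi a i lt = trans (cong (λ q → iterate step q (i * 2)) (step-hi a (≤-trans (s≤s z≤n) lt))) (walk-lo (α⁻¹ a) 1 i lt)
    from-lo : ∀ a i → suc (i * 2) < k → iterate step (lo a 0) (suc (i * 2)) ≡ hi (α a) (suc (i * 2))
    from-lo a i lt = trans (cong (λ q → iterate step q (i * 2)) (step-lo a (≤-trans (s≤s z≤n) lt))) (walk-hi (α a) 1 i lt)
    odd-hi : ∀ i → i * 2 < k → ∃[ j ] j < k × toℕ (hi (ι 0) (i * 2)) ≡ suc (2 * j)
    -- The position is k + 2i = 2 (h + i) + 1.
    odd-hi i lt = h + i , subst (h + i <_) (sym k≡) (s≤s (≤-trans (+-monoʳ-≤ h i≤h) (≤-reflexive (double h)))) , (begin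
      toℕ (hi (ι 0) (i * 2))     ≡⟨ toℕ-hi₀ lt ⟩
      k + i * 2                  ≡⟨ cong (_+ i * 2) k≡ ⟩
      suc (h * 2 + i * 2)        ≡⟨ cong suc (rearrange h i) ⟩
      suc (2 * (h + i))          ∎)
      where
      double : ∀ h → h + h ≡ h * 2
      double = solve-∀
      rearrange : ∀ h i → h * 2 + i * 2 ≡ 2 * (h + i)
      rearrange = solve-∀
      i≤h : i ≤ h
      i≤h = *-cancelʳ-≤ i h 2 (s≤s⁻¹ (subst (i * 2 <_) k≡ lt))
    odd-lo : ∀ i → suc (i * 2) < k → ∃[ j ] j < k × toℕ (lo (ι 0) (suc (i * 2))) ≡ suc (2 * j)
    odd-lo i lt = i , ≤-trans (s≤s (≤-trans (m≤m*n i 2) (n≤1+n (i * 2)))) lt ,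
      trans (toℕ-lo₀ lt) (cong suc (*-comm i 2))
    by : ∃[ a ] ∃[ s ] s < k × (p ≡ lo a s ⊎ p ≡ hi a s) → ∃[ j ] j < k × toℕ p ≡ suc (2 * j)
    by (a , s , s<k , at) = parity (even⊎odd s) at
      where
      parity : ∃[ i ] (s ≡ i * 2 ⊎ s ≡ suc (i * 2)) → p ≡ lo a s ⊎ p ≡ hi a s → ∃[ j ] j < k × toℕ p ≡ suc (2 * j)
      parity (i , inj₁ refl) (inj₁ p≡) = absurd-lo a (i * 2) (trans (walk-lo a 0 i s<k) (sym p≡))
      parity (i , inj₂ refl) (inj₁ p≡) =
        subst (λ q → ∃[ j ] j < k × toℕ q ≡ suc (2 * j)) (sym (trans p≡ (cong (λ c → lo c (suc (i * 2))) a≡0))) (odd-lo i s<k)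
        where
        αa≡0 : α a ≡ ι 0
        αa≡0 = fixed-hi (α a) (suc (i * 2)) (trans (from-hi (α a) i s<k) (trans (cong (λ c → lo c (suc (i * 2))) (α⁻¹-α a)) (sym p≡)))
        a≡0 : a ≡ ι 0
        a≡0 = trans (sym (α⁻¹-α a)) (trans (cong α⁻¹ (trans αa≡0 (sym α-0))) (α⁻¹-α (ι 0)))
      parity (i , inj₁ refl) (inj₂ p≡) =
        subst (λ q → ∃[ j ] j < k × toℕ q ≡ suc (2 * j)) (sym (trans p≡ (cong (λ c → hi c (i * 2)) a≡0))) (odd-hi i s<k)
        where
        a≡0 : a ≡ ι 0
        a≡0 = fixed-hi a (i * 2) (trans (walk-hi a 0 i s<k) (sym p≡))
      parity (i , inj₂ refl) (inj₂ p≡) = absurd-lo (α⁻¹ a) (suc (i * 2))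
        (trans (from-lo (α⁻¹ a) i s<k) (trans (cong (λ c → hi c (suc (i * 2))) (α-α⁻¹ a)) (sym p≡)))

-- Half-systems: ℤ_v ∖ J as a disjoint union of pairs {d , −d}

record HalfSystem (v t : ℕ) .{{_ : NonZero v}} .{{_ : NonZero t}} (I : Set) : Set where
  field
    value      : I × Sign → Fin v
    find       : Fin v → I × Sign
    value∉J    : ∀ i → ¬ (value i ∈⟨ v / t ⟩)
    find-value : ∀ i → find (value i) ≡ i
    value-find : ∀ d → ¬ (d ∈⟨ v / t ⟩) → value (find d) ≡ d
    value-flip : ∀ i → value (flip i) ≡ neg (value i)

  value-injective : ∀ {i j} → value i ≡ value j → i ≡ j
  value-injective {i} {j} eq = trans (sym (find-value i)) (trans (cong find eq) (find-value j))

xor-cancelʳ : ∀ β ε → (β xor ε) xor ε ≡ β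
xor-cancelʳ false false = refl
xor-cancelʳ false true  = refl
xor-cancelʳ true  false = refl
xor-cancelʳ true  true  = refl

not-xor : ∀ β ε → not β xor ε ≡ not (β xor ε)
not-xor false ε = refl
not-xor true  ε = sym (not-involutive ε)

-- This is all the freedom of the construction: the order of the pairs and, in each pair, which of d
-- and - d is called positive.
signedReindex : ∀ {v t} .{{_ : NonZero v}} .{{_ : NonZero t}} {I I′ : Set} →
                I′ ↔ I → (I′ → Sign) → HalfSystem v t I → HalfSystem v t I′
signedReindex {I = I} {I′} π ε H = record
  { value      = value ∘ to
  ; find       = from ∘ find
  ; value∉J    = λ i → value∉J (to i)
  ; find-value = λ i → trans (cong from (find-value (to i))) (from-to i)
  ; value-find = λ d d∉J → trans (cong value (to-from (find d))) (value-find d d∉J)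
  ; value-flip = λ i → trans (cong value (to-flip i)) (value-flip (to i))
  }
  where
  open HalfSystem H
  to : I′ × Sign → I × Sign
  to (i , β) = Inverse.to π i , β xor ε i
  from : I × Sign → I′ × Sign
  from (j , β) = Inverse.from π j , β xor ε (Inverse.from π j)
  from-to : ∀ i → from (to i) ≡ i
  from-to (i , β) = cong₂ _,_ i≡ (trans (cong (λ j → (β xor ε i) xor ε j) i≡) (xor-cancelʳ β (ε i)))
    where
    i≡ : Inverse.from π (Inverse.to π i) ≡ i
    i≡ = Inverse.strictlyInverseʳ π i
  to-from : ∀ i → to (from i) ≡ i
  to-from (j , β) = cong₂ _,_ (Inverse.strictlyInverseˡ π j) (xor-cancelʳ β (ε (Inverse.from π j)))
  to-flip : ∀ i → to (flip i) ≡ flip (to i)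
  to-flip (i , β) = cong (Inverse.to π i ,_) (not-xor β (ε i))

opposite-+ : ∀ {n} (i : Fin n) → suc (toℕ i + toℕ (opposite i)) ≡ n
opposite-+ {n} i = trans (cong (λ j → suc (toℕ i) + j) (opposite-prop i)) (m+[n∸m]≡n (toℕ<n i))

opposite-unique : ∀ {n} (i j : Fin n) → suc (toℕ i + toℕ j) ≡ n → opposite i ≡ j
opposite-unique i j eq = toℕ-injective (+-cancelˡ-≡ (suc (toℕ i)) _ _ (trans (opposite-+ i) (sym eq)))

opposite-combine : ∀ {m n} (i : Fin m) (j : Fin n) → opposite (combine i j) ≡ combine (opposite i) (opposite j)
opposite-combine {m} {n} i j = opposite-unique (combine i j) (combine (opposite i) (opposite j)) (begin
  suc (toℕ (combine i j) + toℕ (combine (opposite i) (opposite j)))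
    ≡⟨ cong suc (cong₂ _+_ (toℕ-combine i j) (toℕ-combine (opposite i) (opposite j))) ⟩
  suc (n * toℕ i + toℕ j + (n * toℕ (opposite i) + toℕ (opposite j)))
    ≡⟨ rearrange n (toℕ i) (toℕ j) (toℕ (opposite i)) (toℕ (opposite j)) ⟩
  suc (toℕ j + toℕ (opposite j)) + n * (toℕ i + toℕ (opposite i))
    ≡⟨ cong (_+ n * (toℕ i + toℕ (opposite i))) (opposite-+ j) ⟩
  n + n * (toℕ i + toℕ (opposite i))
    ≡⟨ *-suc n (toℕ i + toℕ (opposite i)) ⟨
  n * suc (toℕ i + toℕ (opposite i))
    ≡⟨ cong (n *_) (opposite-+ i) ⟩
  n * m
    ≡⟨ *-comm n m ⟩
  m * n ∎)
  where
  rearrange : ∀ n a b c d → suc (n * a + b + (n * c + d)) ≡ suc (b + d) + n * (a + c)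
  rearrange = solve-∀

-- The half-system of ℤ_v ∖ J in increasing order

module Standard (t u m : ℕ) .{{_ : NonZero t}} .{{_ : NonZero u}} .{{_ : NonZero m}}
                .{{_ : NonZero (t * suc u)}} (tu≡2m : t * u ≡ m + m) where

  v : ℕ
  v = t * suc u

  v/t≡ : v / t ≡ suc u
  v/t≡ = trans (/-congˡ (*-comm t (suc u))) (m*n/n≡m (suc u) t)

  residue : Fin v → Fin (suc u)
  residue d = proj₂ (remQuot {t} (suc u) d)

  toℕ-residue : ∀ d → toℕ (residue d) ≡ toℕ d % suc u
  toℕ-residue d = begin
    toℕ c                                ≡⟨ m<n⇒m%n≡m (toℕ<n c) ⟨
    toℕ c % suc u                        ≡⟨ [m+kn]%n≡m%n (toℕ c) (toℕ a) (suc u) ⟨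
    (toℕ c + toℕ a * suc u) % suc u      ≡⟨ cong (_% suc u) (trans (+-comm (toℕ c) _) (cong (_+ toℕ c) (*-comm (toℕ a) (suc u)))) ⟩
    (suc u * toℕ a + toℕ c) % suc u      ≡⟨ cong (_% suc u) (toℕ-combine a c) ⟨
    toℕ (combine a c) % suc u            ≡⟨ cong (λ d → toℕ d % suc u) (combine-remQuot {t} (suc u) d) ⟩
    toℕ d % suc u                        ∎
    where
    a = proj₁ (remQuot {t} (suc u) d)
    c = residue d

  ∈J⇒residue≡0 : ∀ d → d ∈⟨ v / t ⟩ → residue d ≡ zero
  ∈J⇒residue≡0 d (i , d≡) = toℕ-injective (begin
    toℕ (residue d)                      ≡⟨ toℕ-residue d ⟩
    toℕ d % suc u                        ≡⟨ cong (λ d → toℕ d % suc u) d≡ι ⟩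
    toℕ (ι {v} (i * (v / t))) % suc u    ≡⟨ cong (_% suc u) (toℕ-ι {v} (i * (v / t))) ⟩
    i * (v / t) % v % suc u              ≡⟨ m∣n⇒o%n%m≡o%m (suc u) v (i * (v / t)) (n∣m*n t) ⟩
    i * (v / t) % suc u                  ≡⟨ cong (λ q → i * q % suc u) v/t≡ ⟩
    i * suc u % suc u                    ≡⟨ m*n%n≡0 i (suc u) ⟩
    0                                    ∎)
    where
    d≡ι : d ≡ ι (i * (v / t))
    d≡ι = d≡

  residue≡0⇒∈J : ∀ d → residue d ≡ zero → d ∈⟨ v / t ⟩
  residue≡0⇒∈J d eq = toℕ d / suc u , multiple
    where
    multiple : d ≡ ι (toℕ d / suc u * (v / t))
    multiple = begin
      d                                            ≡⟨ ι-toℕ d ⟨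
      ι (toℕ d)                                    ≡⟨ cong ι (m≡m%n+[m/n]*n (toℕ d) (suc u)) ⟩
      ι (toℕ d % suc u + toℕ d / suc u * suc u)    ≡⟨ cong (λ r → ι (r + toℕ d / suc u * suc u)) (trans (sym (toℕ-residue d)) (cong toℕ eq)) ⟩
      ι (toℕ d / suc u * suc u)                    ≡⟨ cong (λ q → ι (toℕ d / suc u * q)) v/t≡ ⟨
      ι (toℕ d / suc u * (v / t))                  ∎

  ∈J? : ∀ (d : Fin v) → Dec (d ∈⟨ v / t ⟩)
  ∈J? d = map′ (residue≡0⇒∈J d) (∈J⇒residue≡0 d) (residue d ≟ᶠ zero)

  1<v : 1 < v
  1<v = ≤-trans (s≤s (>-nonZero⁻¹ u)) (m≤n*m (suc u) t)

  1∉J : ¬ (ι {v} 1 ∈⟨ v / t ⟩)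
  1∉J 1∈J = contradiction (begin
    1                        ≡⟨ m<n⇒m%n≡m (s≤s (>-nonZero⁻¹ u)) ⟨
    1 % suc u                ≡⟨ cong (_% suc u) (toℕ-ι-< 1<v) ⟨
    toℕ (ι {v} 1) % suc u    ≡⟨ toℕ-residue (ι 1) ⟨
    toℕ (residue (ι 1))      ≡⟨ cong toℕ (∈J⇒residue≡0 (ι 1) 1∈J) ⟩
    0                        ∎) λ ()

  -- The elements of ℤ_v ∖ J in increasing order.
  nth : Fin (t * u) → Fin v
  nth j = combine (proj₁ (remQuot {t} u j)) (suc (proj₂ (remQuot {t} u j)))

  nth-combine : ∀ (a : Fin t) (c : Fin u) → nth (combine a c) ≡ combine a (suc c)
  nth-combine a c = cong (λ r → combine (proj₁ r) (suc (proj₂ r))) (remQuot-combine a c)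

  residue-combine : ∀ (a : Fin t) (c : Fin (suc u)) → residue (combine a c) ≡ c
  residue-combine a c = cong proj₂ (remQuot-combine a c)

  nth∉J : ∀ j → ¬ (nth j ∈⟨ v / t ⟩)
  nth∉J j j∈J = contradiction
    (trans (sym (residue-combine (proj₁ (remQuot {t} u j)) (suc (proj₂ (remQuot {t} u j))))) (∈J⇒residue≡0 (nth j) j∈J)) λ ()

  -- Negation reverses the increasing order. Digit by digit, the multiples of u + 1 add up to t - 1
  -- and the nonzero residues to u + 1, so the total is v.
  nth-opposite : ∀ j → nth (opposite j) ≡ neg (nth j)
  nth-opposite j = inverseʳ-unique (nth j) (nth (opposite j)) (begin
    nth j ⊕ nth (opposite j)                                   ≡⟨ cong₂ _⊕_ (ι-toℕ (nth j)) (ι-toℕ (nth (opposite j))) ⟨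
    ι (toℕ (nth j)) ⊕ ι (toℕ (nth (opposite j)))               ≡⟨ ι-+ (toℕ (nth j)) (toℕ (nth (opposite j))) ⟨
    ι (toℕ (nth j) + toℕ (nth (opposite j)))                   ≡⟨ cong ι total ⟩
    ι v                                                        ≡⟨ ι-v ⟩
    ι 0                                                        ∎)
    where
    open AbelianGroupProperties (ℤ/ v) using (inverseʳ-unique)
    a = proj₁ (remQuot {t} u j)
    c = proj₂ (remQuot {t} u j)
    nth-opp : nth (opposite j) ≡ combine (opposite a) (suc (opposite c))
    nth-opp = begin
      nth (opposite j)                              ≡⟨ cong (nth ∘ opposite) (combine-remQuot {t} u j) ⟨
      nth (opposite (combine a c))                  ≡⟨ cong nth (opposite-combine a c) ⟩
      nth (combine (opposite a) (opposite c))       ≡⟨ nth-combine (opposite a) (opposite c) ⟩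
      combine (opposite a) (suc (opposite c))       ∎
    total : toℕ (nth j) + toℕ (nth (opposite j)) ≡ v
    total = begin
      toℕ (combine a (suc c)) + toℕ (nth (opposite j))
        ≡⟨ cong₂ _+_ (toℕ-combine a (suc c)) (trans (cong toℕ nth-opp) (toℕ-combine (opposite a) (suc (opposite c)))) ⟩
      suc u * toℕ a + suc (toℕ c) + (suc u * toℕ (opposite a) + suc (toℕ (opposite c)))
        ≡⟨ rearrange (suc u) (toℕ a) (toℕ c) (toℕ (opposite a)) (toℕ (opposite c)) ⟩
      suc u * (toℕ a + toℕ (opposite a)) + suc (suc (toℕ c + toℕ (opposite c)))
        ≡⟨ cong (λ r → suc u * (toℕ a + toℕ (opposite a)) + suc r) (opposite-+ c) ⟩
      suc u * (toℕ a + toℕ (opposite a)) + suc u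
        ≡⟨ trans (+-comm _ (suc u)) (sym (*-suc (suc u) (toℕ a + toℕ (opposite a)))) ⟩
      suc u * suc (toℕ a + toℕ (opposite a))
        ≡⟨ cong (suc u *_) (opposite-+ a) ⟩
      suc u * t
        ≡⟨ *-comm (suc u) t ⟩
      v ∎
      where
      rearrange : ∀ q a b c d → q * a + suc b + (q * c + suc d) ≡ q * (a + c) + suc (suc (b + d))
      rearrange = solve-∀

  -- Below u + 1 the only element of J is 0, which accounts for the shift by one.
  nth-small : ∀ j → toℕ j < u → nth j ≡ ι (suc (toℕ j))
  nth-small j j<u = trans (sym (ι-toℕ (nth j))) (cong ι (begin
    toℕ (combine a (suc c))                  ≡⟨ toℕ-combine a (suc c) ⟩
    suc u * toℕ a + suc (toℕ c)              ≡⟨ cong (λ r → suc u * r + suc (toℕ c)) a≡0 ⟩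
    suc u * 0 + suc (toℕ c)                  ≡⟨ cong (_+ suc (toℕ c)) (*-zeroʳ (suc u)) ⟩
    suc (toℕ c)                              ≡⟨ cong (λ r → suc (r + toℕ c)) (*-zeroʳ u) ⟨
    suc (u * 0 + toℕ c)                      ≡⟨ cong (λ r → suc (u * r + toℕ c)) a≡0 ⟨
    suc (u * toℕ a + toℕ c)                  ≡⟨ cong suc j≡ ⟨
    suc (toℕ j)                              ∎))
    where
    a = proj₁ (remQuot {t} u j)
    c = proj₂ (remQuot {t} u j)
    j≡ : toℕ j ≡ u * toℕ a + toℕ c
    j≡ = trans (cong toℕ (sym (combine-remQuot {t} u j))) (toℕ-combine a c)
    a≡0 : toℕ a ≡ 0
    a≡0 = n<1⇒n≡0 (*-cancelˡ-< u (toℕ a) 1 (≤-<-trans (≤-trans (m≤m+n (u * toℕ a) (toℕ c)) (≤-reflexive (sym j≡))) (subst (toℕ j <_) (sym (*-identityʳ u)) j<u)))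

  m≤tu : m ≤ t * u
  m≤tu = ≤-trans (m≤m+n m m) (≤-reflexive (sym tu≡2m))

  first : Fin m → Fin (t * u)
  first i = inject≤ i m≤tu

  -- The value on J is junk.
  rank′ : Fin t → Fin (suc u) → Fin (t * u)
  rank′ a zero    = first (ι 0)
  rank′ a (suc c) = combine a c

  rank : Fin v → Fin (t * u)
  rank d = rank′ (proj₁ (remQuot {t} (suc u) d)) (residue d)

  rank-nth : ∀ j → rank (nth j) ≡ j
  rank-nth j = trans (cong (λ r → rank′ (proj₁ r) (proj₂ r)) (remQuot-combine (proj₁ (remQuot {t} u j)) (suc (proj₂ (remQuot {t} u j)))))
                     (combine-remQuot {t} u j)

  nth-rank : ∀ d → ¬ (d ∈⟨ v / t ⟩) → nth (rank d) ≡ d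
  nth-rank d d∉J = trans (by (residue d) refl) (combine-remQuot {t} (suc u) d)
    where
    a = proj₁ (remQuot {t} (suc u) d)
    by : ∀ c → residue d ≡ c → nth (rank′ a c) ≡ combine a c
    by zero    eq = contradiction (residue≡0⇒∈J d eq) d∉J
    by (suc c) eq = nth-combine a c

  -- As tu = 2m, reflection exchanges the lower m ranks with the upper m. The lower half thus
  -- contains exactly one member of each pair.
  place : Fin m × Sign → Fin (t * u)
  place (i , false) = first i
  place (i , true)  = opposite (first i)

  place-flip : ∀ i → place (flip i) ≡ opposite (place i)
  place-flip (i , false) = refl
  place-flip (i , true)  = sym (opposite-involutive (first i))

  opposite-first : ∀ j → ¬ (toℕ j < m) → toℕ (opposite j) < m
  opposite-first j j≮m = +-cancelˡ-< m _ m (≤-trans (s≤s (+-monoˡ-≤ (toℕ (opposite j)) (≮⇒≥ j≮m))) (≤-reflexive (trans (opposite-+ j) tu≡2m)))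

  first-fromℕ< : ∀ {j} (j<m : toℕ j < m) → first (fromℕ< j<m) ≡ j
  first-fromℕ< j<m = toℕ-injective (trans (toℕ-inject≤ (fromℕ< j<m) m≤tu) (toℕ-fromℕ< j<m))

  toℕ-first<m : ∀ i → toℕ (first i) < m
  toℕ-first<m i = subst (_< m) (sym (toℕ-inject≤ i m≤tu)) (toℕ<n i)

  opposite-first≮m : ∀ i → ¬ (toℕ (opposite (first i)) < m)
  opposite-first≮m i lt = <⇒≢ (subst (_≤ m + m) (cong suc (+-suc (toℕ (first i)) (toℕ (opposite (first i))))) (+-mono-≤ (toℕ-first<m i) lt))
    (trans (opposite-+ (first i)) tu≡2m)

  unplace : Fin (t * u) → Fin m × Sign
  unplace j with toℕ j <? m
  ... | yes j<m = fromℕ< j<m , false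
  ... | no  j≮m = fromℕ< (opposite-first j j≮m) , true

  place-unplace : ∀ j → place (unplace j) ≡ j
  place-unplace j with toℕ j <? m
  ... | yes j<m = first-fromℕ< j<m
  ... | no  j≮m = trans (cong opposite (first-fromℕ< (opposite-first j j≮m))) (opposite-involutive j)

  unplace-place : ∀ i → unplace (place i) ≡ i
  unplace-place (i , false) with toℕ (first i) <? m
  ... | yes i<m = cong (_, false) (toℕ-injective (trans (toℕ-fromℕ< i<m) (toℕ-inject≤ i m≤tu)))
  ... | no  i≮m = contradiction (toℕ-first<m i) i≮m
  unplace-place (i , true) with toℕ (opposite (first i)) <? m
  ... | yes i<m = contradiction i<m (opposite-first≮m i)
  ... | no  i≮m = cong (_, true) (toℕ-injective (begin
    toℕ (fromℕ< (opposite-first (opposite (first i)) i≮m))     ≡⟨ toℕ-fromℕ< (opposite-first (opposite (first i)) i≮m) ⟩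
    toℕ (opposite (opposite (first i)))                        ≡⟨ cong toℕ (opposite-involutive (first i)) ⟩
    toℕ (first i)                                              ≡⟨ toℕ-inject≤ i m≤tu ⟩
    toℕ i                                                      ∎))

  standard : HalfSystem v t (Fin m)
  standard = record
    { value      = nth ∘ place
    ; find       = unplace ∘ rank
    ; value∉J    = λ i → nth∉J (place i)
    ; find-value = λ i → trans (cong unplace (rank-nth (place i))) (unplace-place i)
    ; value-find = λ d d∉J → trans (cong nth (place-unplace (rank d))) (nth-rank d d∉J)
    ; value-flip = λ i → trans (cong nth (place-flip i)) (nth-opposite (place i))
    }

  standard-small : ∀ i → toℕ i < u → HalfSystem.value standard (i , false) ≡ ι (suc (toℕ i))
  standard-small i i<u = trans (nth-small (first i) (subst (_< u) (sym (toℕ-inject≤ i m≤tu)) i<u))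
    (cong (λ j → ι (suc j)) (toℕ-inject≤ i m≤tu))

-- A common value at position 0 supplies the starting point which a cyclic order lacks; the rotation
-- at the single vertex 0 then yields the following values one after another.
rotation-determines-b : ∀ {v t M} .{{_ : NonZero v}} .{{_ : NonZero t}} .{{_ : NonZero M}} (B B′ : NeighbourCycle v t M) →
                        SameRotation (Rotational.Π B) (Rotational.Π B′) →
                        NeighbourCycle.b B (ι 0) ≡ NeighbourCycle.b B′ (ι 0) →
                        ∀ p → NeighbourCycle.b B p ≡ NeighbourCycle.b B′ p
rotation-determines-b {v} {M = M} B B′ same b₀≡ p =
  trans (cong R.b (sym (ι-toℕ p))) (trans (agree (toℕ p)) (cong R′.b (ι-toℕ p)))
  where
  module R = Rotational B
  module R′ = Rotational B′
  x : Fin v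
  x = ι 0
  successor : ∀ a → ι {M} (suc a) ≡ ι a ⊕ ι 1
  successor a = trans (cong ι (+-comm 1 a)) (ι-+ a 1)
  agree : ∀ a → R.b (ι a) ≡ R′.b (ι a)
  agree zero    = b₀≡
  agree (suc a) = trans (cong R.b (successor a)) (trans (⊕-cancelˡ x _ _ (cong tgt (begin
    R.mk x (ι a ⊕ ι 1)       ≡⟨ R.turn-mk x (ι a) ⟨
    R.turn (R.mk x (ι a))    ≡⟨ same (R.mk x (ι a)) ⟩
    R′.turn (R.mk x (ι a))   ≡⟨ cong R′.turn (R.dart-≡ {R.mk x (ι a)} {R′.mk x (ι a)} refl (cong (x ⊕_) (agree a))) ⟩
    R′.turn (R′.mk x (ι a))  ≡⟨ R′.turn-mk x (ι a) ⟩
    R′.mk x (ι a ⊕ ι 1)      ∎))) (cong R′.b (sym (successor a))))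

-- The embedding of a half-system and its prescribed face

module Assembly {v t n k h : ℕ} .{{_ : NonZero v}} .{{_ : NonZero t}} .{{_ : NonZero n}} .{{_ : NonZero k}}
                .{{_ : NonZero (2 * k)}} .{{_ : NonZero (n * (2 * k))}}
                (τ : Twist n) (k≡ : k ≡ suc (h * 2))
                (∈J? : ∀ (d : Fin v) → Dec (d ∈⟨ v / t ⟩)) (1∉J : ¬ (ι {v} 1 ∈⟨ v / t ⟩))
                (H : HalfSystem v t (Fin n × Fin k)) where

  open Twist τ
  open Positions τ k h k≡
  open HalfSystem H

  cycle : NeighbourCycle v t M
  cycle = record
    { b      = value ∘ pair
    ; pos    = unpair ∘ find
    ; star   = mate
    ; b∉J    = λ p → value∉J (pair p)
    ; pos-b  = λ p → trans (cong unpair (find-value (pair p))) (unpair-pair p)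
    ; b-pos  = λ d d∉J → trans (cong value (pair-unpair (find d))) (value-find d d∉J)
    ; b-star = λ p → trans (cong value (pair-unpair (flip (pair p)))) (value-flip (pair p))
    ; ∈J?    = ∈J?
    ; 1∉J    = 1∉J
    }

  open Rotational cycle
  open Automorphisms cycle

  k-odd : k % 2 ≡ 1
  k-odd = trans (cong (_% 2) k≡) ([m+kn]%n≡m%n 1 h 2)

  biembedded : IsBiembedding Π
  biembedded = biembedding (n∣m*n n) k-odd mate-mod

  faces : FaceLengthsMultipleOf k Π
  faces = faceLengths (n∣m*n n) k-odd mate-mod

  b-lo₀ : ∀ {s} (s<k : s < k) → b (lo (ι 0) s) ≡ value ((ι 0 , fromℕ< s<k) , false)
  b-lo₀ s<k = cong value (trans (cong pair (lo≡side (ι 0) s<k)) (pair-side (ι 0) zero (fromℕ< s<k)))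

  iterate-ppos : ∀ d i → ppos (iterate F d i) ≡ iterate step (ppos d) i
  iterate-ppos = iterate-map {h = ppos} ppos-F

  α⁻¹-0 : α⁻¹ (ι 0) ≡ ι 0
  α⁻¹-0 = trans (cong α⁻¹ (sym α-0)) (α⁻¹-α (ι 0))

  Closed : Fin M → Set
  Closed p = ∀ x → iterate F (mk x p) k ≡ mk x p

  closed-step : ∀ {p} → Closed p → Closed (step p)
  closed-step {p} closed x = subst (λ d → iterate F d k ≡ d) F≡ (begin
    iterate F (F (mk y p)) k     ≡⟨ iterate-map {h = F} (λ _ → refl) (mk y p) k ⟨
    F (iterate F (mk y p) k)     ≡⟨ cong F (closed y) ⟩
    F (mk y p)                   ∎)
    where
    -- The vertex from which position p leads to x; closedness is required at all vertices, so it is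
    -- available there.
    y = x ⊕ neg (b p)
    F≡ : F (mk y p) ≡ mk x (step p)
    F≡ = trans (F-mk y p) (cong (λ z → mk z (step p)) ([x⊕neg-y]⊕y≡x x (b p)))

  closed-iterate : ∀ {p} → Closed p → ∀ i → Closed (iterate step p i)
  closed-iterate closed zero    = closed
  closed-iterate closed (suc i) = closed-iterate (closed-step closed) i

  -- The face leaving along hi (ι 0) 0 runs through the values
  -- h, h + 1, − (h + 2), h + 3, …, − 3 h, whose sum is zero.
  module _ (0<h : 0 < h) (value-0 : b (lo (ι 0) 0) ≡ neg (ι h))
           (value-s : ∀ {s} → 0 < s → s < k → b (lo (ι 0) s) ≡ ι (h + s)) where

    b-hi : ∀ {s} → s < k → b (hi (ι 0) s) ≡ neg (b (lo (ι 0) s))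
    b-hi {s} s<k = trans (cong (λ p → b p) (sym (trans (mate-lo (ι 0) s<k) (cong (λ a → hi a s) α-0)))) (b-star (lo (ι 0) s))

    two-steps : ∀ x {s} → suc s < k →
                F (F (mk x (hi (ι 0) s))) ≡ mk ((x ⊕ neg (b (lo (ι 0) s))) ⊕ ι (h + suc s)) (hi (ι 0) (2 + s))
    two-steps x {s} 1+s<k = begin
      F (F (mk x (hi (ι 0) s)))                                      ≡⟨ cong F (F-mk x (hi (ι 0) s)) ⟩
      F (mk (x ⊕ b (hi (ι 0) s)) (step (hi (ι 0) s)))                ≡⟨ cong F (cong₂ mk (cong (x ⊕_) (b-hi s<k)) hi→lo) ⟩
      F (mk y (lo (ι 0) (suc s)))                                    ≡⟨ F-mk y (lo (ι 0) (suc s)) ⟩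
      mk (y ⊕ b (lo (ι 0) (suc s))) (step (lo (ι 0) (suc s)))        ≡⟨ cong₂ mk (cong (y ⊕_) (value-s z<s 1+s<k)) lo→hi ⟩
      mk (y ⊕ ι (h + suc s)) (hi (ι 0) (2 + s))                      ∎
      where
      y = x ⊕ neg (b (lo (ι 0) s))
      s<k = <-trans (n<1+n s) 1+s<k
      hi→lo : step (hi (ι 0) s) ≡ lo (ι 0) (suc s)
      hi→lo = trans (step-hi (ι 0) s<k) (cong (λ a → lo a (suc s)) α⁻¹-0)
      lo→hi : step (lo (ι 0) (suc s)) ≡ hi (ι 0) (2 + s)
      lo→hi = trans (step-lo (ι 0) 1+s<k) (cong (λ a → hi a (2 + s)) α-0)

    -- Two steps from `hi (ι 0) s` add - (h + s) and h + s + 1, a gain of 1. The condition 0 < s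
    -- keeps away from the one value with the other sign.
    walk : ∀ x i {s} → 0 < s → s + i * 2 < k →
           iterate F (mk x (hi (ι 0) s)) (i * 2) ≡ mk (x ⊕ ι i) (hi (ι 0) (s + i * 2))
    walk x zero    {s} _   _  = cong₂ mk (sym (⊕-identityʳ x)) (cong (hi (ι 0)) (sym (+-identityʳ s)))
    walk x (suc i) {s} 0<s lt = begin
      iterate F (F (F (mk x (hi (ι 0) s)))) (i * 2)          ≡⟨ cong (λ d → iterate F d (i * 2)) (two-steps x 1+s<k) ⟩
      iterate F (mk y (hi (ι 0) (2 + s))) (i * 2)            ≡⟨ walk y i z<s lt′ ⟩
      mk (y ⊕ ι i) (hi (ι 0) (2 + s + i * 2))                ≡⟨ cong₂ mk gain (cong (hi (ι 0)) (sym (shift s i))) ⟩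
      mk (x ⊕ ι (suc i)) (hi (ι 0) (s + suc i * 2))          ∎
      where
      shift : ∀ s i → s + (2 + i * 2) ≡ 2 + s + i * 2
      shift = solve-∀
      lt′ : 2 + s + i * 2 < k
      lt′ = subst (_< k) (shift s i) lt
      1+s<k : suc s < k
      1+s<k = ≤-trans (s≤s (s≤s (≤-trans (m≤m+n s (i * 2)) (n≤1+n _)))) lt′
      s<k : s < k
      s<k = <-trans (n<1+n s) 1+s<k
      y = (x ⊕ neg (b (lo (ι 0) s))) ⊕ ι (h + suc s)
      gain : y ⊕ ι i ≡ x ⊕ ι (suc i)
      gain = begin
        ((x ⊕ neg (b (lo (ι 0) s))) ⊕ ι (h + suc s)) ⊕ ι i       ≡⟨ cong (λ z → ((x ⊕ neg z) ⊕ ι (h + suc s)) ⊕ ι i) (value-s 0<s s<k) ⟩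
        ((x ⊕ neg (ι (h + s))) ⊕ ι (h + suc s)) ⊕ ι i            ≡⟨ ⊕-assoc (x ⊕ neg (ι (h + s))) (ι (h + suc s)) (ι i) ⟩
        (x ⊕ neg (ι (h + s))) ⊕ (ι (h + suc s) ⊕ ι i)            ≡⟨ cong ((x ⊕ neg (ι (h + s))) ⊕_) (begin
          ι (h + suc s) ⊕ ι i          ≡⟨ ι-+ (h + suc s) i ⟨
          ι (h + suc s + i)            ≡⟨ cong ι (regroup h s i) ⟩
          ι (h + s + suc i)            ≡⟨ ι-+ (h + s) (suc i) ⟩
          ι (h + s) ⊕ ι (suc i)        ∎) ⟩
        (x ⊕ neg (ι (h + s))) ⊕ (ι (h + s) ⊕ ι (suc i))          ≡⟨ ⊕-assoc (x ⊕ neg (ι (h + s))) (ι (h + s)) (ι (suc i)) ⟨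
        ((x ⊕ neg (ι (h + s))) ⊕ ι (h + s)) ⊕ ι (suc i)          ≡⟨ cong (_⊕ ι (suc i)) ([x⊕neg-y]⊕y≡x x (ι (h + s))) ⟩
        x ⊕ ι (suc i)                                            ∎
        where
        regroup : ∀ h s i → h + suc s + i ≡ h + s + suc i
        regroup = solve-∀

    -- The opening two steps contribute h + (h + 1), each of the next h - 1 pairs of steps
    -- contributes 1, and the last step - 3h. With consecutive values c, ..., c + 2h the same sum
    -- would be c - h, which is why the prescribed values begin with h.
    closed-hi₀ : Closed (hi (ι 0) 0)
    closed-hi₀ x = from-h h refl 0<h
      where
      from-h : ∀ h₀ → h ≡ h₀ → 0 < h₀ → iterate F (mk x (hi (ι 0) 0)) k ≡ mk x (hi (ι 0) 0)
      from-h (suc i) h≡ _ = begin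
        iterate F (mk x (hi (ι 0) 0)) k                          ≡⟨ iterate-k F (mk x (hi (ι 0) 0)) ⟩
        F (iterate F (mk x (hi (ι 0) 0)) (h * 2))                ≡⟨ cong (λ j → F (iterate F (mk x (hi (ι 0) 0)) (j * 2))) h≡ ⟩
        F (iterate F (F (F (mk x (hi (ι 0) 0)))) (i * 2))        ≡⟨ cong (λ d → F (iterate F d (i * 2))) (two-steps x 1<k) ⟩
        F (iterate F (mk y (hi (ι 0) 2)) (i * 2))                ≡⟨ cong F (walk y i z<s 2+2i<k) ⟩
        F (mk (y ⊕ ι i) (hi (ι 0) (suc i * 2)))                  ≡⟨ cong (λ j → F (mk (y ⊕ ι i) (hi (ι 0) (j * 2)))) h≡ ⟨
        F (mk (y ⊕ ι i) (hi (ι 0) (h * 2)))                      ≡⟨ F-mk (y ⊕ ι i) (hi (ι 0) (h * 2)) ⟩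
        mk ((y ⊕ ι i) ⊕ b (hi (ι 0) (h * 2))) (step (hi (ι 0) (h * 2)))
                                                                 ≡⟨ cong₂ mk home last-step ⟩
        mk x (hi (ι 0) 0)                                        ∎
        where
        2+2i<k : 2 + i * 2 < k
        2+2i<k = subst (λ j → j * 2 < k) h≡ 2h<k
        1<k : 1 < k
        1<k = ≤-trans (s≤s (s≤s z≤n)) 2+2i<k
        y = (x ⊕ neg (b (lo (ι 0) 0))) ⊕ ι (h + 1)
        last-step : step (hi (ι 0) (h * 2)) ≡ hi (ι 0) 0
        last-step = begin
          step (hi (ι 0) (h * 2))            ≡⟨ step-hi (ι 0) 2h<k ⟩
          lo (α⁻¹ (ι 0)) (suc (h * 2))       ≡⟨ cong₂ lo α⁻¹-0 (sym k≡) ⟩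
          lo (ι 0) k                         ≡⟨ lo-k (ι 0) ⟩
          hi (ι 0) 0                         ∎
        home : (y ⊕ ι i) ⊕ b (hi (ι 0) (h * 2)) ≡ x
        home = begin
          (y ⊕ ι i) ⊕ b (hi (ι 0) (h * 2))              ≡⟨ cong ((y ⊕ ι i) ⊕_) (trans (b-hi 2h<k) (cong neg (value-s 0<2h 2h<k))) ⟩
          (y ⊕ ι i) ⊕ neg (ι (h + h * 2))               ≡⟨ cong (_⊕ neg (ι (h + h * 2))) (begin
            ((x ⊕ neg (b (lo (ι 0) 0))) ⊕ ι (h + 1)) ⊕ ι i  ≡⟨ cong (λ z → ((x ⊕ z) ⊕ ι (h + 1)) ⊕ ι i) (trans (cong neg value-0) (neg-involutive (ι h))) ⟩
            ((x ⊕ ι h) ⊕ ι (h + 1)) ⊕ ι i                   ≡⟨ cong (_⊕ ι i) (⊕-assoc x (ι h) (ι (h + 1))) ⟩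
            (x ⊕ (ι h ⊕ ι (h + 1))) ⊕ ι i                   ≡⟨ cong (λ z → (x ⊕ z) ⊕ ι i) (ι-+ h (h + 1)) ⟨
            (x ⊕ ι (h + (h + 1))) ⊕ ι i                     ≡⟨ ⊕-assoc x (ι (h + (h + 1))) (ι i) ⟩
            x ⊕ (ι (h + (h + 1)) ⊕ ι i)                     ≡⟨ cong (x ⊕_) (ι-+ (h + (h + 1)) i) ⟨
            x ⊕ ι (h + (h + 1) + i)                         ≡⟨ cong (λ z → x ⊕ ι z) total ⟩
            x ⊕ ι (h + h * 2)                               ∎) ⟩
          (x ⊕ ι (h + h * 2)) ⊕ neg (ι (h + h * 2))     ≡⟨ [x⊕y]⊕neg-y≡x x (ι (h + h * 2)) ⟩
          x                                             ∎
          where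
          0<2h : 0 < h * 2
          0<2h = ≤-trans 0<h (m≤m*n h 2)
          regroup : ∀ h i → h + (h + 1) + i ≡ h + (h + suc i)
          regroup = solve-∀
          double : ∀ h → h + (h + h) ≡ h + h * 2
          double = solve-∀
          total : h + (h + 1) + i ≡ h + h * 2
          total = trans (regroup h i) (trans (cong (λ j → h + (h + j)) (sym h≡)) (double h))

    closed⇒odd : ∀ x p → iterate F (mk x p) k ≡ mk x p → ∃[ j ] j < k × toℕ p ≡ suc (2 * j)
    closed⇒odd x p closed = periodic⇒odd p (begin
      iterate step p k                   ≡⟨ cong (λ q → iterate step q k) (ppos-mk x p) ⟨
      iterate step (ppos (mk x p)) k     ≡⟨ iterate-ppos (mk x p) k ⟨
      ppos (iterate F (mk x p) k)        ≡⟨ cong ppos closed ⟩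
      ppos (mk x p)                      ≡⟨ ppos-mk x p ⟩
      p                                  ∎)

    2k*0 : 2 * k * toℕ {n} (ι 0) ≡ 0
    2k*0 = trans (cong (2 * k *_) (toℕ-ι-< (>-nonZero⁻¹ n))) (*-zeroʳ (2 * k))

    closed-first : Closed (ι 1)
    closed-first = subst Closed first≡ (closed-step closed-hi₀)
      where
      first≡ : step (hi (ι 0) 0) ≡ ι 1
      first≡ = begin
        step (hi (ι 0) 0)     ≡⟨ step-hi (ι 0) (≤-trans (s≤s z≤n) 2h<k) ⟩
        lo (α⁻¹ (ι 0)) 1      ≡⟨ cong (λ a → lo a 1) α⁻¹-0 ⟩
        lo (ι 0) 1            ≡⟨ cong (λ c → ι (c + 1)) 2k*0 ⟩
        ι 1                   ∎

    last≡ : hi (ι 0) (h * 2) ≡ ι (suc (2 * (h * 2)))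
    last≡ = cong ι (begin
      2 * k * toℕ {n} (ι 0) + (k + h * 2)     ≡⟨ cong (_+ (k + h * 2)) 2k*0 ⟩
      k + h * 2                               ≡⟨ cong (_+ h * 2) k≡ ⟩
      suc (h * 2) + h * 2                     ≡⟨ double (h * 2) ⟩
      suc (2 * (h * 2))                       ∎)
      where
      double : ∀ e → suc e + e ≡ suc (2 * e)
      double = solve-∀

    closed-last : Closed (ι (suc (2 * (h * 2))))
    closed-last = subst Closed (trans (walk-hi (ι 0) 0 h 2h<k) last≡) (closed-iterate closed-hi₀ (h * 2))

    -- Both p and k are odd, so the mate is even; α fixes block 0, so the mate stays below 2k.
    mate-odd : ∀ p j → j < k → toℕ p ≡ suc (2 * j) → ∃[ i ] i < k × toℕ (mate p) ≡ 2 * i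
    mate-odd p j j<k p≡ = q / 2 , m<n*o⇒m/o<n (subst (q <_) (*-comm 2 k) (below (side-surjective p))) , (begin
      q                    ≡⟨ m≡m%n+[m/n]*n q 2 ⟩
      q % 2 + q / 2 * 2    ≡⟨ cong (_+ q / 2 * 2) q-even ⟩
      q / 2 * 2            ≡⟨ *-comm (q / 2) 2 ⟩
      2 * (q / 2)          ∎)
      where
      q = toℕ (mate p)
      q-even : q % 2 ≡ 0
      q-even = begin
        q % 2                                ≡⟨ m%d≡n%d⇒m%e≡n%e {m = q} {n = toℕ p + k} (m∣m*n k) (mate-mod p) ⟩
        (toℕ p + k) % 2                      ≡⟨ cong₂ (λ a c → (a + c) % 2) p≡ k≡ ⟩
        (suc (2 * j) + suc (h * 2)) % 2      ≡⟨ cong (_% 2) (rearrange j h) ⟩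
        (suc (j + h) * 2) % 2                ≡⟨ m*n%n≡0 (suc (j + h)) 2 ⟩
        0                                    ∎
        where
        rearrange : ∀ j h → suc (2 * j) + suc (h * 2) ≡ suc (j + h) * 2
        rearrange = solve-∀
      p<2k : toℕ p < 2 * k
      p<2k = ≤-trans (≤-reflexive (cong suc p≡)) (≤-trans (≤-reflexive (sym (*-suc 2 j))) (*-monoʳ-≤ 2 j<k))
      in-block : ∀ a e s → p ≡ side a e s → a ≡ ι 0
      in-block a e s p≡side = toℕ-injective (trans (n<1⇒n≡0 (*-cancelˡ-< (2 * k) (toℕ a) 1
        (≤-<-trans (≤-trans (m≤m+n (2 * k * toℕ a) _) (≤-reflexive (sym (trans (cong toℕ p≡side) (toℕ-side a e s)))))
          (subst (toℕ p <_) (sym (*-identityʳ (2 * k))) p<2k))))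
        (sym (toℕ-ι-< (>-nonZero⁻¹ n))))
      k+k≡2k : k + k ≡ 2 * k
      k+k≡2k = cong (k +_) (sym (+-identityʳ k))
      below : ∃[ a ] ∃[ e ] ∃[ s ] p ≡ side a e s → q < 2 * k
      below (a , zero , s , p≡side) = ≤-trans (≤-reflexive (cong suc q≡)) (≤-trans (+-monoʳ-< k (toℕ<n s)) (≤-reflexive k+k≡2k))
        where
        q≡ : q ≡ k + toℕ s
        q≡ = begin
          toℕ (mate p)                         ≡⟨ cong (toℕ ∘ mate) (trans p≡side (cong (λ a → side a zero s) (in-block a zero s p≡side))) ⟩
          toℕ (mate (side (ι 0) zero s))       ≡⟨ cong toℕ (trans (mate-side-lo (ι 0) s) (cong (λ a → side a (suc zero) s) α-0)) ⟩
          toℕ (side (ι 0) (suc zero) s)        ≡⟨ cong toℕ (side≡hi (ι 0) s) ⟩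
          toℕ (hi (ι 0) (toℕ s))               ≡⟨ toℕ-hi₀ (toℕ<n s) ⟩
          k + toℕ s                            ∎
      below (a , suc zero , s , p≡side) = ≤-trans (≤-reflexive (cong suc q≡)) (≤-trans (toℕ<n s) (m≤n*m k 2))
        where
        q≡ : q ≡ toℕ s
        q≡ = begin
          toℕ (mate p)                         ≡⟨ cong (toℕ ∘ mate) (trans p≡side (cong (λ a → side a (suc zero) s) (in-block a (suc zero) s p≡side))) ⟩
          toℕ (mate (side (ι 0) (suc zero) s)) ≡⟨ cong toℕ (trans (mate-side-hi (ι 0) s) (cong (λ a → side a zero s) α⁻¹-0)) ⟩
          toℕ (side (ι 0) zero s)              ≡⟨ cong toℕ (side≡lo (ι 0) s) ⟩
          toℕ (lo (ι 0) (toℕ s))               ≡⟨ toℕ-lo₀ (toℕ<n s) ⟩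
          toℕ s                                ∎

    first-position : ι {M} 0 ≡ lo (ι 0) 0
    first-position = cong ι (sym (trans (+-identityʳ _) 2k*0))

    automorphisms : 2 ≤ n → 8 * h < v → AutIsℤᵥ Π
    -- Here k = e + 1 with e = 2h, so the last closed position 2e + 1 is 2k - 1, the one that
    -- carries - 3h.
    automorphisms 2≤n 8h<v = autIsℤᵥ (h * 2) (subst (λ κ → 4 * κ ≤ M) k≡ 4k≤M)
      (subst (λ κ → ∀ x p → iterate F (mk x p) κ ≡ mk x p → ∃[ j ] j < κ × toℕ p ≡ suc (2 * j)) k≡ closed⇒odd)
      (subst (λ κ → ∀ x → iterate F (mk x (ι 1)) κ ≡ mk x (ι 1)) k≡ closed-first)
      (subst (λ κ → ∀ x → iterate F (mk x (ι (suc (2 * (h * 2))))) κ ≡ mk x (ι (suc (2 * (h * 2))))) k≡ closed-last)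
      (subst (λ κ → ∀ p j → j < κ → toℕ p ≡ suc (2 * j) → ∃[ i ] i < κ × toℕ (mate p) ≡ 2 * i) k≡ mate-odd)
      h 0<h 8h<v
      (trans (cong (λ p → b p) first-position) value-0)
      (begin
        b (ι (suc (2 * (h * 2))))     ≡⟨ cong (λ p → b p) last≡ ⟨
        b (hi (ι 0) (h * 2))          ≡⟨ b-hi 2h<k ⟩
        neg (b (lo (ι 0) (h * 2)))    ≡⟨ cong neg (value-s (≤-trans 0<h (m≤m*n h 2)) 2h<k) ⟩
        neg (ι (h + h * 2))           ≡⟨ cong (λ c → neg (ι c)) (triple h) ⟩
        neg (ι (3 * h))               ∎)
      where
      triple : ∀ h → h + h * 2 ≡ 3 * h
      triple = solve-∀
      4k≤M : 4 * k ≤ M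
      4k≤M = ≤-trans (≤-reflexive (*-assoc 2 2 k)) (*-monoˡ-≤ (2 * k) 2≤n)

-- Signed permutations

-- The factorial number system: the leading digit is the image of `zero`, the remaining digits
-- number the permutation of what is left.
permutationOf : ∀ r → Fin (r !) → Permutation′ r
permutationOf zero    _ = idₚ
permutationOf (suc r) i = insert zero (proj₁ (remQuot {suc r} (r !) i)) (permutationOf r (proj₂ (remQuot {suc r} (r !) i)))

permutationOf-injective : ∀ r i j → (∀ x → permutationOf r i ⟨$⟩ʳ x ≡ permutationOf r j ⟨$⟩ʳ x) → i ≡ j
permutationOf-injective zero    zero zero _  = refl
permutationOf-injective (suc r) i j same = begin
  i                  ≡⟨ combine-remQuot {suc r} (r !) i ⟨
  combine (head i) (tail i)     ≡⟨ cong₂ combine (same zero) (permutationOf-injective r (tail i) (tail j) same-tail) ⟩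
  combine (head j) (tail j)     ≡⟨ combine-remQuot {suc r} (r !) j ⟩
  j                  ∎
  where
  head : Fin (suc r !) → Fin (suc r)
  head i = proj₁ (remQuot {suc r} (r !) i)
  tail : Fin (suc r !) → Fin (r !)
  tail i = proj₂ (remQuot {suc r} (r !) i)
  same-tail : ∀ x → permutationOf r (tail i) ⟨$⟩ʳ x ≡ permutationOf r (tail j) ⟨$⟩ʳ x
  same-tail x = punchIn-injective (head i) _ _ (begin
    punchIn (head i) (permutationOf r (tail i) ⟨$⟩ʳ x)     ≡⟨ insert-punchIn zero (head i) (permutationOf r (tail i)) x ⟨
    permutationOf (suc r) i ⟨$⟩ʳ suc x                     ≡⟨ same (suc x) ⟩
    permutationOf (suc r) j ⟨$⟩ʳ suc x                     ≡⟨ insert-punchIn zero (head j) (permutationOf r (tail j)) x ⟩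
    punchIn (head j) (permutationOf r (tail j) ⟨$⟩ʳ x)     ≡⟨ cong (λ c → punchIn c (permutationOf r (tail j) ⟨$⟩ʳ x)) (same zero) ⟨
    punchIn (head i) (permutationOf r (tail j) ⟨$⟩ʳ x)     ∎)

finToFun-injective : ∀ m r (i j : Fin (m ^ r)) → (∀ x → finToFun {m} {r} i x ≡ finToFun {m} {r} j x) → i ≡ j
finToFun-injective m zero    zero zero _ = refl
finToFun-injective m (suc r) i j same = begin
  i                              ≡⟨ combine-remQuot {m} (m ^ r) i ⟨
  combine (head i) (tail i)      ≡⟨ cong₂ combine (same zero) (finToFun-injective m r (tail i) (tail j) (same ∘ suc)) ⟩
  combine (head j) (tail j)      ≡⟨ combine-remQuot {m} (m ^ r) j ⟩
  j                              ∎
  where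
  head : Fin (m ^ suc r) → Fin m
  head i = proj₁ (remQuot {m} (m ^ r) i)
  tail : Fin (m ^ suc r) → Fin (m ^ r)
  tail i = proj₂ (remQuot {m} (m ^ r) i)

signsOf : ∀ r → Fin (2 ^ r) → Fin r → Sign
signsOf r i x = Inverse.to 2↔Bool (finToFun {2} {r} i x)

signsOf-injective : ∀ r i j → (∀ x → signsOf r i x ≡ signsOf r j x) → i ≡ j
signsOf-injective r i j same = finToFun-injective 2 r i j λ x →
  trans (sym (Inverse.strictlyInverseʳ 2↔Bool (finToFun {2} {r} i x)))
    (trans (cong (Inverse.from 2↔Bool) (same x)) (Inverse.strictlyInverseʳ 2↔Bool (finToFun {2} {r} j x)))

-- Each of the k largest factors of (k + r)! is at most b.
[k+r]!≤r!*b^k : ∀ k {r b} → k + r ≤ b → (k + r) ! ≤ r ! * b ^ k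
[k+r]!≤r!*b^k zero    {r} _     = ≤-reflexive (sym (*-identityʳ (r !)))
[k+r]!≤r!*b^k (suc k) {r} {b} k+r<b = ≤-trans
  (*-mono-≤ k+r<b ([k+r]!≤r!*b^k k (<⇒≤ k+r<b)))
  (≤-reflexive (rearrange b (r !) (b ^ k)))
  where
  rearrange : ∀ b f p → b * (f * p) ≡ f * (b * p)
  rearrange = solve-∀

-- The origin of the constant 7: 49 ≤ 64, whereas 36 > 32. With c = 7 + j, the induction step uses
-- that 2c² exceeds (c + 1)² by c² - 2c - 1 = 34 + 12j + j².
[7+j]²≤2^[6+j] : ∀ j → (7 + j) * (7 + j) ≤ 2 ^ (6 + j)
[7+j]²≤2^[6+j] zero    = m≤m+n 49 15
[7+j]²≤2^[6+j] (suc j) = ≤-trans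
  (≤-trans (m≤m+n ((8 + j) * (8 + j)) (34 + 12 * j + j * j)) (≤-reflexive (grow j)))
  (*-monoʳ-≤ 2 ([7+j]²≤2^[6+j] j))
  where
  grow : ∀ j → (8 + j) * (8 + j) + (34 + 12 * j + j * j) ≡ 2 * ((7 + j) * (7 + j))
  grow = solve-∀

-- The family of embeddings

module Family (t u n h′ k : ℕ) .{{_ : NonZero t}} .{{_ : NonZero u}} .{{_ : NonZero (t * suc u)}} .{{_ : NonZero k}}
              .{{_ : NonZero (suc n * k)}} .{{_ : NonZero (2 * k)}} .{{_ : NonZero (suc n * (2 * k))}}
              (k≡ : k ≡ suc (suc h′ * 2)) (2<n : 2 < n) (tu≡2m : t * u ≡ suc n * k + suc n * k)
              (3h≤u : 3 * suc h′ ≤ u) (8h<v : 8 * suc h′ < t * suc u) where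

  h : ℕ
  h = suc h′

  open Standard t u (suc n * k) tu≡2m

  Index : Set
  Index = Fin (suc n) × Fin k

  -- Block zero is set aside for the prescribed values; π moves only the pairs of the other n
  -- blocks.
  blocks : Permutation′ (n * k) → Index ↔ (Fin k ⊎ Fin (n * k))
  blocks π = mk↔ₛ′ to from to-from from-to
    where
    to : Index → Fin k ⊎ Fin (n * k)
    to (zero  , s) = inj₁ s
    to (suc a , s) = inj₂ (π ⟨$⟩ʳ combine a s)
    from : Fin k ⊎ Fin (n * k) → Index
    from (inj₁ s) = zero , s
    from (inj₂ i) = map₁ suc (remQuot {n} k (π ⟨$⟩ˡ i))
    to-from : ∀ i → to (from i) ≡ i
    to-from (inj₁ s) = refl
    to-from (inj₂ i) = cong inj₂ (trans (cong (π ⟨$⟩ʳ_) (combine-remQuot {n} k (π ⟨$⟩ˡ i))) (inverseʳ π))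
    from-to : ∀ i → from (to i) ≡ i
    from-to (zero  , s) = refl
    from-to (suc a , s) = cong (map₁ suc) (trans (cong (remQuot {n} k) (inverseˡ π)) (remQuot-combine a s))

  -- In `standard`, a small index i has the value i + 1. The shift by h′ = h - 1 therefore puts h,
  -- ..., 3h into block zero.
  rotate : Permutation′ (suc n * k)
  rotate = mk↔ₛ′ (_⊕ ι h′) (_⊕ neg (ι h′)) (λ x → [x⊕neg-y]⊕y≡x x (ι h′)) (λ x → [x⊕y]⊕neg-y≡x x (ι h′))

  label : Permutation′ (n * k) → Index ↔ Fin (suc n * k)
  label π = rotate ↔-∘ (↔-sym +↔⊎ ↔-∘ blocks π)

  -- The minus sign at s = 0 makes the prescribed face leave with + h; without it, the values would
  -- sum to - 2h.
  sign : (Fin (n * k) → Sign) → Index → Sign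
  sign ε (zero  , s) = toℕ s ≡ᵇ 0
  sign ε (suc a , s) = ε (combine a s)

  halfSystem : Permutation′ (n * k) → (Fin (n * k) → Sign) → HalfSystem v t Index
  halfSystem π ε = signedReindex (label π) (sign ε) standard

  τ : Twist (suc n)
  τ = twist n 2<n

  module At (π : Permutation′ (n * k)) (ε : Fin (n * k) → Sign) where

    open Positions τ k h k≡ public using (lo; unpair; pair-unpair)
    open HalfSystem (halfSystem π ε) public
    open Assembly {h = h} τ k≡ ∈J? 1∉J (halfSystem π ε) public
    open Rotational cycle public using (b; Π)

    toℕ-label : ∀ s → toℕ (Inverse.to (label π) (zero , s)) ≡ toℕ s + h′
    toℕ-label s = begin
      toℕ ((s ↑ˡ n * k) ⊕ ι h′)                         ≡⟨ m<n⇒m%n≡m (toℕ<n ((s ↑ˡ n * k) ⊕ ι h′)) ⟨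
      toℕ ((s ↑ˡ n * k) ⊕ ι h′) % (suc n * k)           ≡⟨ %-⊕ ∣-refl (s ↑ˡ n * k) h′ ⟩
      (toℕ (s ↑ˡ n * k) + h′) % (suc n * k)             ≡⟨ cong (λ c → (c + h′) % (suc n * k)) (toℕ-↑ˡ s (n * k)) ⟩
      (toℕ s + h′) % (suc n * k)                        ≡⟨ m<n⇒m%n≡m s+h′<m ⟩
      toℕ s + h′                                        ∎
      where
      h′≤k : h′ ≤ k
      h′≤k = ≤-trans (≤-trans (m≤m*n h′ 2) (m≤n+m (h′ * 2) 3)) (≤-reflexive (sym k≡))
      s+h′<m : toℕ s + h′ < suc n * k
      s+h′<m = +-mono-<-≤ (toℕ<n s) (≤-trans h′≤k (m≤n*m k n {{>-nonZero (≤-trans (s≤s z≤n) 2<n)}}))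

    value-label : ∀ s → HalfSystem.value standard (Inverse.to (label π) (zero , s) , false) ≡ ι (h + toℕ s)
    value-label s = trans (standard-small (Inverse.to (label π) (zero , s)) label<u)
      (cong ι (trans (cong suc (toℕ-label s)) (cong suc (+-comm (toℕ s) h′))))
      where
      rearrange : ∀ h → h + suc h * 2 ≡ 2 + 3 * h
      rearrange = solve-∀
      triple : ∀ h → suc (2 + 3 * h) ≡ 3 * suc h
      triple = solve-∀
      -- The largest prescribed value is 3h, and `standard-small` covers the values up to u.
      label<u : toℕ (Inverse.to (label π) (zero , s)) < u
      label<u = ≤-trans (≤-reflexive (cong suc (trans (toℕ-label s) (+-comm (toℕ s) h′))))
        (≤-trans (s≤s (+-monoʳ-≤ h′ (s≤s⁻¹ (subst (toℕ s <_) k≡ (toℕ<n s)))))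
          (≤-trans (≤-reflexive (trans (cong suc (rearrange h′)) (triple h′))) 3h≤u))

    0<k : 0 < k
    0<k = subst (0 <_) (sym k≡) z<s

    value-0 : b (lo (ι 0) 0) ≡ neg (ι h)
    value-0 = begin
      b (lo (ι 0) 0)                                                     ≡⟨ b-lo₀ 0<k ⟩
      HalfSystem.value standard (Inverse.to (label π) (zero , s) , (toℕ s ≡ᵇ 0))   ≡⟨ cong (λ c → HalfSystem.value standard (Inverse.to (label π) (zero , s) , (c ≡ᵇ 0))) (toℕ-fromℕ< 0<k) ⟩
      HalfSystem.value standard (Inverse.to (label π) (zero , s) , true)     ≡⟨ HalfSystem.value-flip standard (Inverse.to (label π) (zero , s) , false) ⟩
      neg (HalfSystem.value standard (Inverse.to (label π) (zero , s) , false)) ≡⟨ cong neg (value-label s) ⟩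
      neg (ι (h + toℕ s))                                                ≡⟨ cong (λ c → neg (ι c)) (trans (cong (h +_) (toℕ-fromℕ< 0<k)) (+-identityʳ h)) ⟩
      neg (ι h)                                                          ∎
      where s = fromℕ< 0<k

    value-s : ∀ {s} → 0 < s → s < k → b (lo (ι 0) s) ≡ ι (h + s)
    value-s {s@(suc _)} _ s<k = begin
      b (lo (ι 0) s)                                                     ≡⟨ b-lo₀ s<k ⟩
      HalfSystem.value standard (Inverse.to (label π) (zero , s′) , (toℕ s′ ≡ᵇ 0))  ≡⟨ cong (λ c → HalfSystem.value standard (Inverse.to (label π) (zero , s′) , (c ≡ᵇ 0))) (toℕ-fromℕ< s<k) ⟩
      HalfSystem.value standard (Inverse.to (label π) (zero , s′) , false)   ≡⟨ value-label s′ ⟩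
      ι (h + toℕ s′)                                                     ≡⟨ cong (λ c → ι (h + c)) (toℕ-fromℕ< s<k) ⟩
      ι (h + s)                                                          ∎
      where s′ = fromℕ< s<k

    good : IsBiembedding Π × AutIsℤᵥ Π × FaceLengthsMultipleOf k Π
    good = biembedded , automorphisms z<s value-0 value-s (s≤s (≤-trans (s≤s z≤n) 2<n)) 8h<v , faces

  -- Both listings carry - h at position 0, so equal rotations come from equal listings. Injectivity
  -- of `standard` on signed indices then separates the label of each free pair, which gives π, from
  -- its sign, which gives ε.
  determined : ∀ {π ε π′ ε′} → SameRotation (At.Π π ε) (At.Π π′ ε′) →
               (∀ x → π ⟨$⟩ʳ x ≡ π′ ⟨$⟩ʳ x) × (∀ x → ε x ≡ ε′ x)
  determined {π} {ε} {π′} {ε′} same = (λ x → proj₁ (agree x)) , (λ x → proj₂ (agree x))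
    where
    module A = At π ε
    module A′ = At π′ ε′
    first≡ : ι 0 ≡ A.lo (ι 0) 0
    first≡ = cong ι (sym (trans (+-identityʳ (2 * k * 0)) (*-zeroʳ (2 * k))))
    b≡ : ∀ p → A.b p ≡ A′.b p
    b≡ = rotation-determines-b A.cycle A′.cycle same
      (trans (cong (λ p → A.b p) first≡) (trans A.value-0 (trans (sym A′.value-0) (cong (λ p → A′.b p) (sym first≡)))))
    value≡ : ∀ i → A.value i ≡ A′.value i
    value≡ i = begin
      A.value i                            ≡⟨ cong A.value (A.pair-unpair i) ⟨
      A.b (A.unpair i)                     ≡⟨ b≡ (A.unpair i) ⟩
      A′.b (A.unpair i)                    ≡⟨ cong A′.value (A.pair-unpair i) ⟩
      A′.value i                           ∎
    agree : ∀ x → π ⟨$⟩ʳ x ≡ π′ ⟨$⟩ʳ x × ε x ≡ ε′ x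
    agree x =
      subst (λ y → π ⟨$⟩ʳ y ≡ π′ ⟨$⟩ʳ y) (combine-remQuot {n} k x)
        (↑ʳ-injective k _ _ (⊕-cancelʳ (ι h′) _ _ (,-injectiveˡ labels≡))) ,
      subst (λ y → ε y ≡ ε′ y) (combine-remQuot {n} k x) (,-injectiveʳ labels≡)
      where
      i : Index
      i = map₁ suc (remQuot {n} k x)
      labels≡ : (Inverse.to (label π) i , sign ε i) ≡ (Inverse.to (label π′) i , sign ε′ i)
      labels≡ = HalfSystem.value-injective standard (value≡ (i , false))

  atLeast : AtLeast {Γ = completeMultipartite v t} ((n * k) ! * 2 ^ (n * k))
              (λ Π → IsBiembedding Π × AutIsℤᵥ Π × FaceLengthsMultipleOf k Π)
  atLeast = Π , (λ i → At.good (π i) (ε i)) , distinct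
    where
    N₁ N₂ : ℕ
    N₁ = (n * k) !
    N₂ = 2 ^ (n * k)
    π : Fin (N₁ * N₂) → Permutation′ (n * k)
    π i = permutationOf (n * k) (proj₁ (remQuot {N₁} N₂ i))
    ε : Fin (N₁ * N₂) → Fin (n * k) → Sign
    ε i = signsOf (n * k) (proj₂ (remQuot {N₁} N₂ i))
    Π : Fin (N₁ * N₂) → Embedding (completeMultipartite v t)
    Π i = At.Π (π i) (ε i)
    distinct : ∀ i j → SameRotation (Π i) (Π j) → i ≡ j
    distinct i j same = begin
      i                                  ≡⟨ combine-remQuot {N₁} N₂ i ⟨
      combine (proj₁ (remQuot {N₁} N₂ i)) (proj₂ (remQuot {N₁} N₂ i))
        ≡⟨ cong₂ combine (permutationOf-injective (n * k) _ _ (proj₁ same′)) (signsOf-injective (n * k) _ _ (proj₂ same′)) ⟩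
      combine (proj₁ (remQuot {N₁} N₂ j)) (proj₂ (remQuot {N₁} N₂ j))
                                         ≡⟨ combine-remQuot {N₁} N₂ j ⟩
      j                                  ∎
      where
      same′ : (∀ x → π i ⟨$⟩ʳ x ≡ π j ⟨$⟩ʳ x) × (∀ x → ε i x ≡ ε j x)
      same′ = determined {π i} {ε i} {π j} {ε j} same

-- The bound

open import Data.Integer.Base using (+_)
import Data.Integer.Base as ℤ
import Data.Integer.Properties as ℤₚ
open import Data.Rational.Unnormalised.Base using (1ℚᵘ; *≤*) renaming (_≤_ to _≤ℚ_; _-_ to _-ℚ_; _*_ to _*ℚ_; _/_ to _/ℚ_)
import Data.Rational.Unnormalised.Properties as ℚᵘₚ

-- If m ≤ C, the factor 1 - C / m is not positive and any N will do. The factor never exceeds 1, so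
-- f ≤ N is enough otherwise.
lowerBound : ∀ C m f N .{{_ : NonZero m}} → m ≤ C ⊎ f ≤ N →
             ((1ℚᵘ -ℚ ((+ C) /ℚ m)) *ℚ ((+ f) /ℚ 1)) ≤ℚ ((+ N) /ℚ 1)
lowerBound C m@(suc _) f N = λ
  { (inj₁ m≤C) → ℚᵘₚ.≤-trans (ℚᵘₚ.*-monoˡ-≤-nonNeg ((+ f) /ℚ 1) (ℚᵘₚ.p≤q⇒p-q≤0 (1≤ m≤C)))
                   (ℚᵘₚ.≤-trans (ℚᵘₚ.≤-reflexive (ℚᵘₚ.*-zeroˡ ((+ f) /ℚ 1))) (ℚᵘₚ.nonNegative⁻¹ ((+ N) /ℚ 1)))
  ; (inj₂ f≤N) → ℚᵘₚ.≤-trans (ℚᵘₚ.*-monoˡ-≤-nonNeg ((+ f) /ℚ 1) ≤1)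
                   (ℚᵘₚ.≤-trans (ℚᵘₚ.≤-reflexive (ℚᵘₚ.*-identityˡ ((+ f) /ℚ 1))) (*≤* (ℤₚ.*-monoʳ-≤-nonNeg (+ 1) (ℤ.+≤+ f≤N))))
  }
  where
  1≤ : m ≤ C → 1ℚᵘ ≤ℚ ((+ C) /ℚ m)
  1≤ m≤C = *≤* (subst₂ ℤ._≤_ (sym (ℤₚ.*-identityˡ (+ m))) (sym (ℤₚ.*-identityʳ (+ C))) (ℤ.+≤+ m≤C))
  ≤1 : (1ℚᵘ -ℚ ((+ C) /ℚ m)) ≤ℚ 1ℚᵘ
  ≤1 = ℚᵘₚ.≤-trans (ℚᵘₚ.+-monoʳ-≤ 1ℚᵘ (ℚᵘₚ.neg-mono-≤ (ℚᵘₚ.nonNegative⁻¹ ((+ C) /ℚ m)))) (ℚᵘₚ.≤-reflexive (ℚᵘₚ.+-identityʳ 1ℚᵘ))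

Biembeddings : (v t k N : ℕ) .{{_ : NonZero t}} → Set
Biembeddings v t k N = AtLeast {Γ = completeMultipartite v t} N (λ Π → IsBiembedding Π × AutIsℤᵥ Π × FaceLengthsMultipleOf k Π)

noBiembeddings : ∀ {v t k} .{{_ : NonZero t}} → Biembeddings v t k 0
noBiembeddings = (λ ()) , (λ ()) , (λ ())

odd-factorʳ : ∀ n k → (n * k) % 2 ≡ 1 → ∃[ h ] k ≡ suc (h * 2)
odd-factorʳ n k nk-odd with even⊎odd k
... | h , inj₂ k≡ = h , k≡
... | i , inj₁ k≡ = contradiction (begin
  1                    ≡⟨ nk-odd ⟨
  (n * k) % 2          ≡⟨ cong (λ c → (n * c) % 2) k≡ ⟩
  (n * (i * 2)) % 2    ≡⟨ cong (_% 2) (*-assoc n i 2) ⟨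
  (n * i * 2) % 2      ≡⟨ m*n%n≡0 (n * i) 2 ⟩
  0                    ∎) λ ()

-- The size condition serves to force n > 7 + t. Here 7 is what the count and the inequality 8h < v
-- require, and t is what brings the prescribed values below v / t.
manyBiembeddings : ∀ t n k .{{_ : NonZero t}} → k < n → (7 + t) * (7 + t) < n * k → t ∣ 2 * n * k → (n * k) % 2 ≡ 1 → 3 ≤ k →
        Σ[ N ∈ ℕ ] (n * k) ! ≤ N × Biembeddings (2 * n * k + t) t k N
manyBiembeddings t n@(suc n′) k k<n C<nk (divides u 2nk≡ut) nk-odd 3≤k with odd-factorʳ n k nk-odd
... | zero , refl = contradiction 3≤k λ { (s≤s ()) }
... | suc h′ , refl =
  (n′ * k) ! * 2 ^ (n′ * k) , enough ,
  subst (λ v → Biembeddings v t k ((n′ * k) ! * 2 ^ (n′ * k))) v≡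
    (Family.atLeast t u n′ h′ k {{_}} {{>-nonZero (≤-trans (s≤s z≤n) 3h≤u)}} {{>-nonZero (≤-trans (s≤s z≤n) 8h<v)}} refl (≤-trans (s≤s (s≤s (s≤s z≤n))) 6≤n′) tu≡ 3h≤u 8h<v)
  where
  -- Otherwise k < n ≤ 7 + t, and nk would not exceed (7 + t)².
  7+t<n : 7 + t < n
  7+t<n = ≰⇒> λ n≤7+t → <⇒≱ C<nk (*-mono-≤ n≤7+t (≤-trans (<⇒≤ k<n) n≤7+t))
  6≤n′ : 6 ≤ n′
  6≤n′ = s≤s⁻¹ (≤-trans (m≤m+n 7 t) (<⇒≤ 7+t<n))
  tu≡ : t * u ≡ n * k + n * k
  tu≡ = trans (*-comm t u) (trans (sym 2nk≡ut) (double n k))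
    where
    double : ∀ n k → 2 * n * k ≡ n * k + n * k
    double = solve-∀
  v≡ : t * suc u ≡ 2 * n * k + t
  v≡ = trans (*-suc t u) (trans (+-comm t (t * u)) (cong (_+ t) (trans (*-comm t u) (sym 2nk≡ut))))
  -- From tu = 2nk and t ≤ n. Since 3h < 2k, the prescribed values stay below u + 1 = v / t and so
  -- avoid J.
  2k≤u : 2 * k ≤ u
  2k≤u = *-cancelˡ-≤ t (≤-trans (*-monoˡ-≤ (2 * k) (≤-trans (m≤n+m t 7) (<⇒≤ 7+t<n)))
    (≤-reflexive (trans (rearrange n k) (sym tu≡))))
    where
    rearrange : ∀ n k → n * (2 * k) ≡ n * k + n * k
    rearrange = solve-∀
  3h≤u : 3 * suc h′ ≤ u
  3h≤u = ≤-trans (≤-trans (m≤m+n (3 * suc h′) (3 + h′)) (≤-reflexive (rearrange h′))) 2k≤u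
    where
    rearrange : ∀ h → 3 * suc h + (3 + h) ≡ 2 * suc (suc h * 2)
    rearrange = solve-∀
  -- Indeed v > tu = 2nk ≥ 14k = 28h + 14.
  8h<v : 8 * suc h′ < t * suc u
  8h<v = ≤-trans (s≤s (≤-trans (m≤m+n (8 * suc h′) (20 * suc h′ + 14)) (≤-reflexive (rearrange h′))))
    (≤-trans (s≤s (≤-trans (+-mono-≤ 7k≤nk 7k≤nk) (≤-reflexive (sym tu≡))))
      (≤-trans (+-monoˡ-≤ (t * u) (>-nonZero⁻¹ t)) (≤-reflexive (sym (*-suc t u)))))
    where
    7k≤nk : 7 * k ≤ n * k
    7k≤nk = *-monoˡ-≤ k (s≤s 6≤n′)
    rearrange : ∀ h → 8 * suc h + (20 * suc h + 14) ≡ 7 * suc (suc h * 2) + 7 * suc (suc h * 2)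
    rearrange = solve-∀
  -- Each of the k factors lost is at most nk ≤ n² ≤ 2^(n-1), and the product of these k powers is
  -- exactly the number of sign choices.
  enough : (n * k) ! ≤ (n′ * k) ! * 2 ^ (n′ * k)
  enough = ≤-trans ([k+r]!≤r!*b^k k nk≤2^n′) (≤-reflexive (cong ((n′ * k) ! *_) (^-*-assoc 2 n′ k)))
    where
    nk≤2^n′ : k + n′ * k ≤ 2 ^ n′
    nk≤2^n′ = ≤-trans (*-monoʳ-≤ n (<⇒≤ k<n)) (subst (λ c → suc c * suc c ≤ 2 ^ c) (m+[n∸m]≡n 6≤n′) ([7+j]²≤2^[6+j] (n′ ∸ 6)))

corollary4p10 : ∀ (t : ℕ) .{{_ : NonZero t}} → t % 4 ≢ 0 →
    Σ[ C ∈ ℕ ]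
    (∀ (n k : ℕ) .{{_ : NonZero n}} .{{_ : NonZero k}} →
    k < n →
    t ∣ 2 * n * k →
    ( ((n * k) % 2 ≡ 1 × n ≥ k × k ≥ 3 × gcd n (k ∸ 1) ≡ 1)
    ⊎ ((n * k) % 2 ≡ 1 × n ≥ k × 3 < k × k < 200)
    ⊎ ((n * k) % 2 ≡ 1 × n ≥ k × k ≥ 3 × n ≥ (k ∸ 2) * (k ∸ 1)) ) →
    Σ[ N ∈ ℕ ]
    ( ((1ℚᵘ -ℚ (_/ℚ_ (+ C) (n * k) {{m*n≢0 n k}})) *ℚ ((+ ((n * k) !)) /ℚ 1)) ≤ℚ ((+ N) /ℚ 1)
    × AtLeast {Γ = completeMultipartite (2 * n * k + t) t} N
    (λ Π → IsBiembedding Π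
    × AutIsℤᵥ Π
    × FaceLengthsMultipleOf k Π) ))
corollary4p10 t _ = C , bound
  where
  C : ℕ
  -- Since k < n, this exceeds nk whenever n ≤ 7 + t; for nk ≤ C the claimed bound is not positive
  -- and the empty family meets it.
  C = (7 + t) * (7 + t)
  oddAndLarge : ∀ {n k} →
    ( ((n * k) % 2 ≡ 1 × n ≥ k × k ≥ 3 × gcd n (k ∸ 1) ≡ 1)
    ⊎ ((n * k) % 2 ≡ 1 × n ≥ k × 3 < k × k < 200)
    ⊎ ((n * k) % 2 ≡ 1 × n ≥ k × k ≥ 3 × n ≥ (k ∸ 2) * (k ∸ 1)) ) →
    (n * k) % 2 ≡ 1 × 3 ≤ k
  oddAndLarge (inj₁ (odd , _ , 3≤k , _))        = odd , 3≤k
  oddAndLarge (inj₂ (inj₁ (odd , _ , 3<k , _))) = odd , <⇒≤ 3<k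
  oddAndLarge (inj₂ (inj₂ (odd , _ , 3≤k , _))) = odd , 3≤k
  bound : ∀ (n k : ℕ) .{{_ : NonZero n}} .{{_ : NonZero k}} → k < n → t ∣ 2 * n * k → _ →
          Σ[ N ∈ ℕ ]
          ( ((1ℚᵘ -ℚ (_/ℚ_ (+ C) (n * k) {{m*n≢0 n k}})) *ℚ ((+ ((n * k) !)) /ℚ 1)) ≤ℚ ((+ N) /ℚ 1)
          × Biembeddings (2 * n * k + t) t k N )
  bound n k k<n t∣2nk cases with n * k ≤? C
  ... | yes nk≤C = 0 , lowerBound C (n * k) ((n * k) !) 0 {{m*n≢0 n k}} (inj₁ nk≤C) , noBiembeddings
  ... | no  nk≰C = proj₁ family , lowerBound C (n * k) ((n * k) !) (proj₁ family) {{m*n≢0 n k}} (inj₂ (proj₁ (proj₂ family))) , proj₂ (proj₂ family)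
    where
    family = manyBiembeddings t n k k<n (≰⇒> nk≰C) t∣2nk (proj₁ (oddAndLarge cases)) (proj₂ (oddAndLarge cases))
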